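{- For integers $m,k\ge 0$, let $P(m,k)$ be the number of partial matchings of $[m]$ with exactly $k$ arcs that contain no $2$-right crossings and no right nestings. Then, as formal power series in $x$ and $y$, $$\sum_{n\geq 1}\sum_{k=0}^{n-1}P(n+k-1,k)\,x^n y^k=\sum_{n\geq 1}\frac{x^n(1+xy)^{\binom{n}{2}}}{\prod_{k=0}^{n-1}\bigl(1-(1+xy)^k xy\bigr)}.$$
   Context: $[m]=\{1,2,\ldots,m\}$, with $[0]=\emptyset$ (which has exactly one partition, the empty one). A partial matching of $[m]$ is a set partition of $[m]$ in which every block has at most two elements; each two-element block $\{i,j\}$ with $i<j$ is called an arc and written $(i,j)$. A right nesting is a pair of arcs $(i_1,j_1)$, $(i_2,j_2)$ with $i_1<i_2<j_2<j_1$ and $j_1=j_2+1$. A $2$-right crossing is a pair of arcs $(i_1,j_1)$, $(i_2,j_2)$ with $i_1<i_2<j_1<j_2$ and $j_2-j_1\le 2$. -}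

module Defs where

open import Algebra.Bundles using (RawRing)
import Algebra.Definitions.RawSemiring as RawSemiringDefs
import Algebra.Properties.Semiring.Sum as SemiringSum
import Data.Bool.Properties as Boolₚ
open import Data.Fin.Base using (Fin; zero; suc; toℕ) renaming (_<_ to _<ᶠ_)
open import Data.Fin.Properties using (any?; toℕ≤pred[n]) renaming (_<?_ to _<ᶠ?_)
open import Data.Fin.Subset
  using (Subset; inside; outside; Nonempty; Empty; ⁅_⁆; _∩_; _∪_; ⋃; ∣_∣; ⊤)
open import Data.Fin.Subset.Properties using (nonempty?)
open import Data.Integer.Base using (ℤ; 0ℤ; 1ℤ)
import Data.Integer.Base as ℤ hiding (+_)
import Data.Integer.Properties as ℤₚ
open import Data.List.Base as List using (List; []; _∷_; _++_; filter; length)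
open import Data.List.Membership.Propositional using (_∈_)
import Data.List.Membership.DecPropositional as DecMembership
open import Data.List.Relation.Unary.All using (All; all?)
open import Data.List.Relation.Unary.AllPairs using (AllPairs; allPairs?)
open import Data.Nat.Base as ℕ using (ℕ; zero; suc; _∸_; _≤_; _<_; s≤s)
import Data.Nat.Properties as ℕₚ
open import Data.Product.Base using (∃-syntax; _×_)
open import Data.Vec.Base using ([]; _∷_)
import Data.Vec.Properties as Vecₚ
open import Function.Base using (_∘_)
open import Level using (0ℓ)
open import Relation.Binary.Definitions using (DecidableEquality)
open import Relation.Binary.PropositionalEquality
  using (_≡_; refl; sym; trans; cong; cong₂; module ≡-Reasoning)
open import Relation.Nullary.Decidable using (Dec; ¬?; _×-dec_)
open import Relation.Nullary.Negation using (¬_)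
open import Relation.Unary using (Decidable)

private
  variable
    m : ℕ

------------------------------------------------------------------------
-- Partial matchings.  The ground set [m] = {1,…,m} is represented by
-- Fin m = {0,…,m-1}; every condition below is invariant under this shift.

_≟ˢ_ : DecidableEquality (Subset m)
_≟ˢ_ = Vecₚ.≡-dec Boolₚ._≟_

sublists : ∀ {A : Set} → List A → List (List A)
sublists []       = [] ∷ []
sublists (a ∷ as) = List.map (a ∷_) (sublists as) ++ sublists as

subsets : ∀ m → List (Subset m)
subsets zero    = [] ∷ []
subsets (suc m) = List.map (inside ∷_) (subsets m) ++ List.map (outside ∷_) (subsets m)

-- A family is a list of subsets.  As `subsets m` lists every subset of [m]
-- exactly once, its sublists list every set of subsets of [m] exactly once.

Family : ℕ → Set
Family m = List (Subset m)

families : ∀ m → List (Family m)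
families m = sublists (subsets m)

IsSetPartition : Family m → Set
IsSetPartition π = All Nonempty π × AllPairs (λ A B → Empty (A ∩ B)) π × ⋃ π ≡ ⊤

IsPartialMatching : Family m → Set
IsPartialMatching π = IsSetPartition π × All (λ B → ∣ B ∣ ≤ 2) π

Arc : Family m → Fin m → Fin m → Set
Arc π i j = i <ᶠ j × (⁅ i ⁆ ∪ ⁅ j ⁆) ∈ π

arcs : Family m → ℕ
arcs π = length (filter (λ B → ∣ B ∣ ℕₚ.≟ 2) π)

RightNesting : Family m → Set
RightNesting π = ∃[ i₁ ] ∃[ j₁ ] ∃[ i₂ ] ∃[ j₂ ]
  Arc π i₁ j₁ × Arc π i₂ j₂ ×
  (i₁ <ᶠ i₂ × i₂ <ᶠ j₂ × j₂ <ᶠ j₁ × toℕ j₁ ≡ toℕ j₂ ℕ.+ 1)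

TwoRightCrossing : Family m → Set
TwoRightCrossing π = ∃[ i₁ ] ∃[ j₁ ] ∃[ i₂ ] ∃[ j₂ ]
  Arc π i₁ j₁ × Arc π i₂ j₂ ×
  (i₁ <ᶠ i₂ × i₂ <ᶠ j₁ × j₁ <ᶠ j₂ × toℕ j₂ ∸ toℕ j₁ ≤ 2)

Counted : ℕ → Family m → Set
Counted k π =
  IsPartialMatching π × arcs π ≡ k × ¬ TwoRightCrossing π × ¬ RightNesting π

arc? : (π : Family m) → ∀ i j → Dec (Arc π i j)
arc? π i j = i <ᶠ? j ×-dec (⁅ i ⁆ ∪ ⁅ j ⁆) ∈? π
  where open DecMembership _≟ˢ_ using (_∈?_)

isSetPartition? : Decidable (IsSetPartition {m})
isSetPartition? π =
  all? nonempty? π ×-dec allPairs? (λ A B → ¬? (nonempty? (A ∩ B))) π ×-dec ⋃ π ≟ˢ ⊤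

isPartialMatching? : Decidable (IsPartialMatching {m})
isPartialMatching? π = isSetPartition? π ×-dec all? (λ B → ∣ B ∣ ℕₚ.≤? 2) π

rightNesting? : Decidable (RightNesting {m})
rightNesting? π = any? λ i₁ → any? λ j₁ → any? λ i₂ → any? λ j₂ →
  arc? π i₁ j₁ ×-dec arc? π i₂ j₂ ×-dec
  (i₁ <ᶠ? i₂ ×-dec i₂ <ᶠ? j₂ ×-dec j₂ <ᶠ? j₁ ×-dec toℕ j₁ ℕₚ.≟ toℕ j₂ ℕ.+ 1)

twoRightCrossing? : Decidable (TwoRightCrossing {m})
twoRightCrossing? π = any? λ i₁ → any? λ j₁ → any? λ i₂ → any? λ j₂ →
  arc? π i₁ j₁ ×-dec arc? π i₂ j₂ ×-dec
  (i₁ <ᶠ? i₂ ×-dec i₂ <ᶠ? j₁ ×-dec j₁ <ᶠ? j₂ ×-dec toℕ j₂ ∸ toℕ j₁ ℕₚ.≤? 2)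

counted? : ∀ k → Decidable (Counted {m} k)
counted? k π =
  isPartialMatching? π ×-dec arcs π ℕₚ.≟ k ×-dec
  ¬? (twoRightCrossing? π) ×-dec ¬? (rightNesting? π)

P : ℕ → ℕ → ℕ
P m k = length (filter (counted? k) (families m))

------------------------------------------------------------------------
-- Formal power series in x and y over ℤ: `f i j` is the coefficient of
-- xⁱ yʲ.

PowerSeries : Set
PowerSeries = ℕ → ℕ → ℤ

infix  4 _≈_
infixl 6 _+_ _-_
infixl 7 _*_

_≈_ : PowerSeries → PowerSeries → Set
f ≈ g = ∀ i j → f i j ≡ g i j

const : ℤ → PowerSeries
const c zero zero = c
const c _    _    = 0ℤ

0# 1# x y : PowerSeries
0# = const 0ℤ
1# = const 1ℤ

x 1 0 = 1ℤ
x _ _ = 0ℤ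

y 0 1 = 1ℤ
y _ _ = 0ℤ

module ℤ-Sum = SemiringSum ℤₚ.+-*-semiring
open ℤ-Sum using () renaming (sum to ℤ-sum)

_+_ _-_ _*_ : PowerSeries → PowerSeries → PowerSeries
(f + g) i j = f i j ℤ.+ g i j
(f - g) i j = f i j ℤ.- g i j
(f * g) i j = ℤ-sum {suc i} λ a → ℤ-sum {suc j} λ b →
  f (toℕ a) (toℕ b) ℤ.* g (i ∸ toℕ a) (j ∸ toℕ b)

powerSeries-rawRing : RawRing 0ℓ 0ℓ
powerSeries-rawRing = record
  { Carrier = PowerSeries
  ; _≈_     = _≈_
  ; _+_     = _+_
  ; _*_     = _*_
  ; -_      = λ f i j → ℤ.- f i j
  ; 0#      = 0#
  ; 1#      = 1#
  }

open RawSemiringDefs (RawRing.rawSemiring powerSeries-rawRing) public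
  using (_^_; sum; product)

infixl 6 sum< product<

sum< product< : ℕ → (ℕ → PowerSeries) → PowerSeries
sum<     n f = sum     {n} (f ∘ toℕ)
product< n f = product {n} (f ∘ toℕ)

syntax sum<     n (λ k → f) = ∑[ k < n ] f
syntax product< n (λ k → f) = ∏[ k < n ] f

-- If f has constant term 1 then f⁻¹ = ∑_{k≥0} (1 - f)ᵏ, and (1 - f)ᵏ has no
-- term of total degree less than k.  `*-inverseʳ` shows that this is indeed
-- the inverse.  The value is meaningless for other constant terms.

infix 9 _⁻¹

_⁻¹ : PowerSeries → PowerSeries
(f ⁻¹) i j = ℤ-sum {suc (i ℕ.+ j)} λ k → ((1# - f) ^ toℕ k) i j

-- `∑[n≥1] F ⟶ S` says that the infinite sum F 1 + F 2 + F 3 + ⋯ converges to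
-- S as a formal power series: each coefficient of the partial sums is
-- eventually equal to that of S.

infix 4 ∑[n≥1]_⟶_

∑[n≥1]_⟶_ : (ℕ → PowerSeries) → PowerSeries → Set
∑[n≥1] F ⟶ S = ∀ i j → ∃[ N ] ∀ M → N ≤ M → (∑[ n < M ] F (suc n)) i j ≡ S i j

------------------------------------------------------------------------
-- Correctness of _⁻¹

private
  open ℤ-Sum using (sum-cong-≗; sum-replicate-zero; ∑-comm; ∑-distrib-+; *-distribˡ-sum)
  open ≡-Reasoning

  sum₂ : ∀ m n → (Fin m → Fin n → ℤ) → ℤ
  sum₂ m n t = ℤ-sum {m} λ a → ℤ-sum {n} (t a)

  sum-zero : ∀ n (t : Fin n → ℤ) → (∀ a → t a ≡ 0ℤ) → ℤ-sum t ≡ 0ℤ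
  sum-zero n t t≡0 = trans (sum-cong-≗ t≡0) (sum-replicate-zero n)

  sum₂-zero : ∀ m n (t : Fin m → Fin n → ℤ) → (∀ a b → t a b ≡ 0ℤ) → sum₂ m n t ≡ 0ℤ
  sum₂-zero m n t t≡0 = sum-zero m (λ a → ℤ-sum (t a)) λ a → sum-zero n (t a) (t≡0 a)

  sum₂-cong : ∀ m n (s t : Fin m → Fin n → ℤ) → (∀ a b → s a b ≡ t a b) → sum₂ m n s ≡ sum₂ m n t
  sum₂-cong m n s t s≡t = sum-cong-≗ λ a → sum-cong-≗ (s≡t a)

  sum₂-+ : ∀ m n (s t : Fin m → Fin n → ℤ) →
           sum₂ m n (λ a b → s a b ℤ.+ t a b) ≡ sum₂ m n s ℤ.+ sum₂ m n t
  sum₂-+ m n s t = trans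
    (sum-cong-≗ λ a → ∑-distrib-+ (s a) (t a))
    (∑-distrib-+ (λ a → ℤ-sum (s a)) (λ a → ℤ-sum (t a)))

  sum₂-sum : ∀ m n p (t : Fin m → Fin n → Fin p → ℤ) →
             sum₂ m n (λ a b → ℤ-sum (t a b)) ≡ ℤ-sum λ k → sum₂ m n (λ a b → t a b k)
  sum₂-sum m n p t = trans
    (sum-cong-≗ λ a → ∑-comm (t a))
    (∑-comm λ a k → ℤ-sum λ b → t a b k)

  term : (f g : PowerSeries) → ∀ i j → Fin (suc i) → Fin (suc j) → ℤ
  term f g i j a b = f (toℕ a) (toℕ b) ℤ.* g (i ∸ toℕ a) (j ∸ toℕ b)

  *-identityˡ : ∀ g → 1# * g ≈ g
  *-identityˡ g i j = begin
    (1# * g) i j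
      ≡⟨ cong₂ ℤ._+_
           (cong₂ ℤ._+_ (ℤₚ.*-identityˡ (g i j))
             (sum-zero j (λ b → term 1# g i j zero (suc b)) λ _ → refl))
           (sum₂-zero i (suc j) (λ a → term 1# g i j (suc a)) λ _ _ → refl) ⟩
    (g i j ℤ.+ 0ℤ) ℤ.+ 0ℤ
      ≡⟨ trans (ℤₚ.+-identityʳ _) (ℤₚ.+-identityʳ _) ⟩
    g i j ∎

  *-distribʳ : ∀ f g h → (f + g) * h ≈ f * h + g * h
  *-distribʳ f g h i j = trans
    (sum₂-cong (suc i) (suc j) (term (f + g) h i j) (λ a b → term f h i j a b ℤ.+ term g h i j a b)
      λ a b → ℤₚ.*-distribʳ-+ (h (i ∸ toℕ a) (j ∸ toℕ b)) (f (toℕ a) (toℕ b)) (g (toℕ a) (toℕ b)))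
    (sum₂-+ (suc i) (suc j) (term f h i j) (term g h i j))

  *-congʳ : ∀ {f g} h → f ≈ g → f * h ≈ g * h
  *-congʳ {f} {g} h f≈g i j = sum₂-cong (suc i) (suc j) (term f h i j) (term g h i j)
    λ a b → cong (λ c → c ℤ.* h (i ∸ toℕ a) (j ∸ toℕ b)) (f≈g (toℕ a) (toℕ b))

  ^-vanish : ∀ u → u 0 0 ≡ 0ℤ → ∀ k i j → i ℕ.+ j < k → (u ^ k) i j ≡ 0ℤ
  ^-vanish u u₀ (suc k) i j (s≤s i+j≤k) =
    sum₂-zero (suc i) (suc j) (term u (u ^ k) i j) λ a b → case a b (toℕ≤pred[n] a) (toℕ≤pred[n] b)
    where
    zeroʳ : ∀ c {d} → d ≡ 0ℤ → c ℤ.* d ≡ 0ℤ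
    zeroʳ c refl = ℤₚ.*-zeroʳ c

    case : ∀ a b → toℕ a ≤ i → toℕ b ≤ j → term u (u ^ k) i j a b ≡ 0ℤ
    case zero zero _ _ =
      trans (cong (λ c → c ℤ.* (u ^ k) i j) u₀) (ℤₚ.*-zeroˡ ((u ^ k) i j))
    case zero b@(suc _) _ b≤j = zeroʳ (u 0 (toℕ b)) (^-vanish u u₀ k _ _
      (ℕₚ.<-≤-trans (ℕₚ.+-monoʳ-< i (ℕₚ.∸-monoʳ-< (s≤s ℕ.z≤n) b≤j)) i+j≤k))
    case a@(suc _) b a≤i _ = zeroʳ (u (toℕ a) (toℕ b)) (^-vanish u u₀ k _ _
      (ℕₚ.<-≤-trans (ℕₚ.+-mono-<-≤ (ℕₚ.∸-monoʳ-< (s≤s ℕ.z≤n) a≤i) (ℕₚ.m∸n≤m j (toℕ b))) i+j≤k))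

  extend : ∀ {m n} (t : ℕ → ℤ) → m ≤ n → (∀ k → m ≤ k → t k ≡ 0ℤ) →
           ℤ-sum {m} (t ∘ toℕ) ≡ ℤ-sum {n} (t ∘ toℕ)
  extend {n = n} t ℕ.z≤n t≡0 = sym (sum-zero n (t ∘ toℕ) λ k → t≡0 (toℕ k) ℕ.z≤n)
  extend t (s≤s m≤n) t≡0 =
    cong (λ c → t 0 ℤ.+ c) (extend (t ∘ suc) m≤n λ k m≤k → t≡0 (suc k) (s≤s m≤k))

  telescope : ∀ n (t : ℕ → ℤ) → ℤ-sum {n} (λ k → t (toℕ k) ℤ.- t (suc (toℕ k))) ≡ t 0 ℤ.- t n
  telescope zero    t = sym (ℤₚ.+-inverseʳ (t 0))
  telescope (suc n) t = trans
    (cong (λ c → (t 0 ℤ.- t 1) ℤ.+ c) (telescope n (t ∘ suc)))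
    (ℤₚ.+-minus-telescope (t 0) (t 1) (t (suc n)))

*-inverseʳ : ∀ f → f 0 0 ≡ 1ℤ → f * f ⁻¹ ≈ 1#
*-inverseʳ f f₀ i j = begin
  (f * f ⁻¹) i j
    ≡⟨ sum₂-cong (suc i) (suc j) (term f (f ⁻¹) i j) (λ a b → ℤ-sum (terms a b)) expand ⟩
  sum₂ (suc i) (suc j) (λ a b → ℤ-sum (terms a b))
    ≡⟨ sum₂-sum (suc i) (suc j) K terms ⟩
  ℤ-sum {K} (λ k → (f * u ^ toℕ k) i j)
    ≡⟨ sum-cong-≗ {K} {λ k → (f * u ^ toℕ k) i j} (λ k → step (toℕ k)) ⟩
  ℤ-sum {K} (λ k → (u ^ toℕ k) i j ℤ.- (u ^ suc (toℕ k)) i j)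
    ≡⟨ telescope K (λ k → (u ^ k) i j) ⟩
  1# i j ℤ.- (u ^ K) i j
    ≡⟨ cong (λ c → 1# i j ℤ.- c) (^-vanish u u₀ K i j ℕₚ.≤-refl) ⟩
  1# i j ℤ.+ 0ℤ
    ≡⟨ ℤₚ.+-identityʳ (1# i j) ⟩
  1# i j ∎
  where
  u = 1# - f
  K = suc (i ℕ.+ j)

  terms : Fin (suc i) → Fin (suc j) → Fin K → ℤ
  terms a b k = term f (u ^ toℕ k) i j a b

  u₀ : u 0 0 ≡ 0ℤ
  u₀ = cong (λ c → 1ℤ ℤ.- c) f₀

  expand : ∀ a b → term f (f ⁻¹) i j a b ≡ ℤ-sum (terms a b)
  expand a b = trans
    (cong (λ c → f (toℕ a) (toℕ b) ℤ.* c)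
      (extend (λ k → (u ^ k) (i ∸ toℕ a) (j ∸ toℕ b))
        (s≤s (ℕₚ.+-mono-≤ (ℕₚ.m∸n≤m i (toℕ a)) (ℕₚ.m∸n≤m j (toℕ b))))
        (λ k → ^-vanish u u₀ k (i ∸ toℕ a) (j ∸ toℕ b))))
    (*-distribˡ-sum {K} (f (toℕ a) (toℕ b)) (λ k → (u ^ toℕ k) (i ∸ toℕ a) (j ∸ toℕ b)))

  cancelʳ : ∀ c d → (c ℤ.+ d) ℤ.- d ≡ c
  cancelʳ c d = trans (ℤₚ.+-assoc c d (ℤ.- d))
    (trans (cong (λ e → c ℤ.+ e) (ℤₚ.+-inverseʳ d)) (ℤₚ.+-identityʳ c))

  f+u≈1 : f + u ≈ 1#
  f+u≈1 a b = begin
    f a b ℤ.+ (1# a b ℤ.- f a b)  ≡⟨ ℤₚ.+-assoc (f a b) (1# a b) (ℤ.- f a b) ⟨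
    (f a b ℤ.+ 1# a b) ℤ.- f a b  ≡⟨ cong (λ c → c ℤ.- f a b) (ℤₚ.+-comm (f a b) (1# a b)) ⟩
    (1# a b ℤ.+ f a b) ℤ.- f a b  ≡⟨ cancelʳ (1# a b) (f a b) ⟩
    1# a b                        ∎

  step : ∀ k → (f * u ^ k) i j ≡ (u ^ k) i j ℤ.- (u ^ suc k) i j
  step k = begin
    p                            ≡⟨ cancelʳ p q ⟨
    (p ℤ.+ q) ℤ.- q              ≡⟨ cong (λ c → c ℤ.- q) (*-distribʳ f u (u ^ k) i j) ⟨
    ((f + u) * u ^ k) i j ℤ.- q  ≡⟨ cong (λ c → c ℤ.- q) (*-congʳ (u ^ k) f+u≈1 i j) ⟩
    (1# * u ^ k) i j ℤ.- q       ≡⟨ cong (λ c → c ℤ.- q) (*-identityˡ (u ^ k) i j) ⟩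
    (u ^ k) i j ℤ.- q            ∎
    where
    p = (f * u ^ k) i j
    q = (u ^ suc k) i j

-- In a matching of the given kind no closer follows a closer, so each closer
-- follows a non-closer.  Scan the positions from left to right and let every
-- closer pick its opener among the earlier non-closers not yet picked.  If the
-- previous closer stands two positions to the left, the pick is either the
-- adjacent position or lies below the previous pick; otherwise it is free.
-- With t = xy and G j r the generating function of the continuations when j
-- non-closers are unpicked and the r lowest of them may be picked next,
--   G j r = 1 + x G (j+1) (j+1) + t (G j j + ∑_{s<r} G j s),
-- so G j r = (1+t)^r G j 0 and
--   (1 - (1+t)^j t) G j j = (1+t)^j (1 + x G (j+1) (j+1)).
-- Iterating the last equation expands x G 0 0 into the right-hand side.

module Submission where

open import Algebra.Bundles using (CommutativeRing; RawRing)
import Algebra.Definitions.RawSemiring as RawSemiringDefs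
open import Algebra.Morphism.Structures using (IsRingMonomorphism)
import Algebra.Morphism.RingMonomorphism as RingMono
import Algebra.Properties.Ring as RingProperties
import Algebra.Properties.Semiring.Exp as SemiringExp
import Algebra.Properties.Semiring.Sum as SemiringSum
import Algebra.Solver.Ring.NaturalCoefficients.Default as NaturalCoefficients
open import Data.Empty using (⊥; ⊥-elim)
open import Data.Fin.Base using (Fin; zero; suc; toℕ; fromℕ<) renaming (_<_ to _<ᶠ_)
open import Data.Fin.Properties as Finₚ using (any?; all?) renaming (_<?_ to _<ᶠ?_)
open import Data.Fin.Subset
  using (Subset; inside; outside; Nonempty; Empty; ⁅_⁆; _∩_; _∪_; ⋃; ∣_∣)
  renaming (_∈_ to _∈ˢ_; ⊥ to ⊥ˢ)
import Data.Fin.Subset.Properties as Subsetₚ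
open import Data.Integer.Base as ℤ using (ℤ; 0ℤ; 1ℤ)
open import Data.Integer.Base using (+_)
import Data.Integer.Properties as ℤₚ
open import Data.List.Base as List using (List; []; _∷_; _++_; filter; length; map; concatMap)
open import Data.List.Membership.Propositional using (_∈_; lose; find)
import Data.List.Membership.Propositional.Properties as ∈ₚ
import Data.List.Properties as Listₚ
open import Data.List.Relation.Unary.All as All using (All; []; _∷_)
import Data.List.Relation.Unary.All.Properties as Allₚ
open import Data.List.Relation.Unary.AllPairs as AllPairs using (AllPairs; []; _∷_)
import Data.List.Relation.Unary.AllPairs.Properties as AllPairsₚ
open import Data.List.Relation.Unary.Any using (here; there; _─_; index)
open import Data.List.Relation.Unary.Unique.Propositional using (Unique)
import Data.List.Relation.Unary.Unique.Propositional.Properties as Uniqueₚ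
open import Data.Maybe.Base using (Maybe; just; nothing)
open import Data.Maybe.Properties as Maybeₚ using (just-injective)
open import Data.Nat.Base as ℕ using (ℕ; zero; suc; _<_; _>_; _≤_; s≤s; z≤n)
open import Data.Nat.Base using (_∸_) renaming (_+_ to _+ℕ_)
open import Data.Nat.Combinatorics using (_C_; nC1≡n; nCk+nC[k+1]≡[n+1]C[k+1])
import Data.Nat.ListAction as Listℕ
import Data.Nat.Properties as ℕₚ
open import Data.Product.Base using (_,_; proj₁; proj₂)
open import Data.Product.Base using (∃-syntax; _×_)
open import Data.Sum.Base as Sum using (_⊎_; inj₁; inj₂)
open import Data.Unit.Base using (⊤; tt)
open import Data.Vec.Base using ([]; _∷_)
import Data.Vec.Properties as Vecₚ
open import Function.Base using (_∘_; id)
open import Level using (0ℓ)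
open import Relation.Binary.Definitions using (tri<; tri≈; tri>) renaming (Decidable to Decidable₂)
import Relation.Binary.PropositionalEquality as ≡
open ≡ using (_≡_; _≢_)
import Relation.Binary.Reasoning.Setoid as SetoidReasoning
open import Relation.Nullary.Decidable using (yes; no; ¬?; _×-dec_; _⊎-dec_; map′)
open import Relation.Nullary.Negation using (¬_; contradiction)
open import Relation.Unary using (Decidable)

-- Two closers cannot be adjacent: the opener of the later one is not the earlier closer, and the
-- two openers give a crossing if they stand in the order of their closers and a right nesting
-- otherwise. At distance 2 only the crossing is forbidden, and at distance 3 or more nothing is. If
-- a pick other than the neighbour has s permitted candidates below it, these are all the unpicked
-- non-closers below it, and a closer two positions later may take one of them or its own neighbour.
-- The neighbour that was passed over replaces the picked non-closer, so j stays the same. After an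
-- adjacent pick all j lie below it, whence `G j j`. Non-closers that are never picked are the
-- singletons, so the scan may stop anywhere, whence the summand 1. `P` counts lists of subsets,
-- whereas the recursion counts words of picks. The two are not compared by a map with an inverse:
-- both are duplicate-free lists, and the relation of having the same arcs is total and injective
-- from either side, which gives two inequalities between the lengths.

-- Convolution over a commutative ring

module Convolution {c ℓ} (R : CommutativeRing c ℓ) where
  private
    module R = CommutativeRing R
    open R using (Carrier; semiring; +-cong; +-congˡ; +-congʳ; *-congˡ; *-congʳ)
    module S = SemiringSum semiring

  conv : (ℕ → Carrier) → (ℕ → Carrier) → ℕ → Carrier
  conv f g i = S.sum {suc i} λ a → f (toℕ a) R.* g (i ∸ toℕ a)

  private
    infix 4 _≋_
    _≋_ : (f g : ℕ → Carrier) → Set ℓ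
    f ≋ g = ∀ i → f i R.≈ g i

    infixl 6 _⊕_
    _⊕_ : (f g : ℕ → Carrier) → ℕ → Carrier
    (f ⊕ g) i = f i R.+ g i

    one : ℕ → Carrier
    one zero    = R.1#
    one (suc _) = R.0#

    open SetoidReasoning R.setoid

    conv-cong : ∀ {f f′ g g′} → f ≋ f′ → g ≋ g′ → conv f g ≋ conv f′ g′
    conv-cong f≋f′ g≋g′ i = S.sum-cong-≋ {suc i} λ a → R.*-cong (f≋f′ (toℕ a)) (g≋g′ (i ∸ toℕ a))

    conv-distribʳ : ∀ h f g → conv (f ⊕ g) h ≋ conv f h ⊕ conv g h
    conv-distribʳ h f g i = R.trans
      (S.sum-cong-≋ {suc i} λ a → R.distribʳ (h (i ∸ toℕ a)) (f (toℕ a)) (g (toℕ a)))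
      (S.∑-distrib-+ {suc i} (λ a → f (toℕ a) R.* h (i ∸ toℕ a)) (λ a → g (toℕ a) R.* h (i ∸ toℕ a)))

    conv-scaleˡ : ∀ d f g → conv (λ i → d R.* f i) g ≋ λ i → d R.* conv f g i
    conv-scaleˡ d f g i = R.trans
      (S.sum-cong-≋ {suc i} λ a → R.*-assoc d (f (toℕ a)) (g (i ∸ toℕ a)))
      (R.sym (S.*-distribˡ-sum {suc i} d λ a → f (toℕ a) R.* g (i ∸ toℕ a)))

    -- `conv` unfolds at its first summand by definition; peeling the last one as well is what lets
    -- commutativity go through by induction.
    conv-last : ∀ f g i → conv f g (suc i) R.≈ f (suc i) R.* g 0 R.+ conv f (g ∘ suc) i
    conv-last f g zero = begin
      f 0 R.* g 1 R.+ (f 1 R.* g 0 R.+ R.0#)  ≈⟨ R.+-comm _ _ ⟩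
      (f 1 R.* g 0 R.+ R.0#) R.+ f 0 R.* g 1  ≈⟨ R.+-assoc _ _ _ ⟩
      f 1 R.* g 0 R.+ (R.0# R.+ f 0 R.* g 1)  ≈⟨ +-congˡ (R.+-comm _ _) ⟩
      f 1 R.* g 0 R.+ (f 0 R.* g 1 R.+ R.0#)  ∎
    conv-last f g (suc i) = begin
      p R.+ conv (f ∘ suc) g (suc i)  ≈⟨ +-congˡ (conv-last (f ∘ suc) g i) ⟩
      p R.+ (q R.+ r)                 ≈⟨ R.+-assoc p q r ⟨
      (p R.+ q) R.+ r                 ≈⟨ +-congʳ (R.+-comm p q) ⟩
      (q R.+ p) R.+ r                 ≈⟨ R.+-assoc q p r ⟩
      q R.+ (p R.+ r)                 ∎
      where
      p = f 0 R.* g (suc (suc i))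
      q = f (suc (suc i)) R.* g 0
      r = conv (f ∘ suc) (g ∘ suc) i

    conv-comm : ∀ f g → conv f g ≋ conv g f
    conv-comm f g zero    = +-congʳ (R.*-comm (f 0) (g 0))
    conv-comm f g (suc i) = begin
      f 0 R.* g (suc i) R.+ conv (f ∘ suc) g i
        ≈⟨ R.+-cong (R.*-comm (f 0) (g (suc i))) (conv-comm (f ∘ suc) g i) ⟩
      g (suc i) R.* f 0 R.+ conv g (f ∘ suc) i
        ≈⟨ conv-last g f i ⟨
      conv g f (suc i) ∎

    conv-assoc : ∀ f g h → conv (conv f g) h ≋ conv f (conv g h)
    conv-assoc f g h zero = begin
      (f 0 R.* g 0 R.+ R.0#) R.* h 0 R.+ R.0#  ≈⟨ +-congʳ (*-congʳ (R.+-identityʳ _)) ⟩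
      f 0 R.* g 0 R.* h 0 R.+ R.0#             ≈⟨ +-congʳ (R.*-assoc _ _ _) ⟩
      f 0 R.* (g 0 R.* h 0) R.+ R.0#           ≈⟨ +-congʳ (*-congˡ (R.+-identityʳ _)) ⟨
      f 0 R.* (g 0 R.* h 0 R.+ R.0#) R.+ R.0#  ∎
    conv-assoc f g h (suc i) = begin
      conv f g 0 R.* h (suc i) R.+ conv (conv f g ∘ suc) h i
        -- `conv f g (suc j)` unfolds by definition to `f 0 * g (suc j)` plus `conv (f ∘ suc) g j`,
        -- so distributivity applies to the shifted factor.
        ≈⟨ +-cong (R.trans (*-congʳ (R.+-identityʳ _)) (R.*-assoc (f 0) (g 0) (h (suc i))))
             (conv-distribʳ h (λ j → f 0 R.* g (suc j)) (conv (f ∘ suc) g) i) ⟩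
      f 0 R.* (g 0 R.* h (suc i)) R.+
        (conv (λ j → f 0 R.* g (suc j)) h i R.+ conv (conv (f ∘ suc) g) h i)
        ≈⟨ R.+-assoc _ _ _ ⟨
      (f 0 R.* (g 0 R.* h (suc i)) R.+ conv (λ j → f 0 R.* g (suc j)) h i) R.+
        conv (conv (f ∘ suc) g) h i
        ≈⟨ +-cong (R.trans (+-congˡ (conv-scaleˡ (f 0) (g ∘ suc) h i))
                    (R.sym (R.distribˡ (f 0) (g 0 R.* h (suc i)) (conv (g ∘ suc) h i))))
             (conv-assoc (f ∘ suc) g h i) ⟩
      f 0 R.* conv g h (suc i) R.+ conv (f ∘ suc) (conv g h) i ∎

    conv-identityˡ : ∀ f → conv one f ≋ f
    conv-identityˡ f zero    = R.trans (R.+-identityʳ _) (R.*-identityˡ (f 0))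
    conv-identityˡ f (suc i) = begin
      R.1# R.* f (suc i) R.+ conv (λ _ → R.0#) f i
        ≈⟨ +-cong (R.*-identityˡ (f (suc i)))
             (R.trans (S.sum-cong-≋ {suc i} λ a → R.zeroˡ (f (i ∸ toℕ a))) (S.sum-replicate-zero (suc i))) ⟩
      f (suc i) R.+ R.0#
        ≈⟨ R.+-identityʳ _ ⟩
      f (suc i) ∎

  commutativeRing : CommutativeRing c ℓ
  commutativeRing = record
    { Carrier = ℕ → Carrier
    ; _≈_ = _≋_
    ; _+_ = _⊕_
    ; _*_ = conv
    ; -_ = λ f i → R.- f i
    ; 0# = λ _ → R.0#
    ; 1# = one
    ; isCommutativeRing = record
      { isRing = record
        { +-isAbelianGroup = record
          { isGroup = record
            { isMonoid = record
              { isSemigroup = record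
                { isMagma = record
                  { isEquivalence = record
                    { refl = λ _ → R.refl
                    ; sym = λ p i → R.sym (p i)
                    ; trans = λ p q i → R.trans (p i) (q i)
                    }
                  ; ∙-cong = λ p q i → +-cong (p i) (q i)
                  }
                ; assoc = λ f g h i → R.+-assoc (f i) (g i) (h i)
                }
              ; identity = (λ f i → R.+-identityˡ (f i)) , (λ f i → R.+-identityʳ (f i))
              }
            ; inverse = (λ f i → R.-‿inverseˡ (f i)) , (λ f i → R.-‿inverseʳ (f i))
            ; ⁻¹-cong = λ p i → R.-‿cong (p i)
            }
          ; comm = λ f g i → R.+-comm (f i) (g i)
          }
        ; *-cong = conv-cong
        ; *-assoc = conv-assoc
        ; *-identity = conv-identityˡ , λ f i → R.trans (conv-comm f one i) (conv-identityˡ f i)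
        ; distrib =
            (λ f g h i → R.trans (conv-comm f (g ⊕ h) i)
              (R.trans (conv-distribʳ f g h i) (+-cong (conv-comm g f i) (conv-comm h f i))))
            , conv-distribʳ
        }
      ; *-comm = conv-comm
      }
    }

-- Solving the recursion in an arbitrary commutative ring

module Telescope {c ℓ} (R : CommutativeRing c ℓ) where
  open CommutativeRing R
  open RawSemiringDefs (RawRing.rawSemiring rawRing)
  open SetoidReasoning setoid
  open SemiringExp semiring using (^-congʳ; ^-homo-*)
  open NaturalCoefficients commutativeSemiring using (solve; _:=_; _:+_; _:*_; con)
  open RingProperties ring using (-‿distribˡ-*)

  private
    sum-last : ∀ n f → sum {suc n} (f ∘ toℕ) ≈ sum {n} (f ∘ toℕ) + f n
    sum-last zero    f = +-comm (f 0) 0#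
    sum-last (suc n) f = trans (+-congˡ (sum-last n (f ∘ suc))) (sym (+-assoc _ _ _))

    product-last : ∀ n f → product {suc n} (f ∘ toℕ) ≈ product {n} (f ∘ toℕ) * f n
    product-last zero    f = *-comm (f 0) 1#
    product-last (suc n) f = trans (*-congˡ (product-last n (f ∘ suc))) (sym (*-assoc _ _ _))

    suc-C-2 : ∀ n → suc n C 2 ≡ n ℕ.+ n C 2
    suc-C-2 n = ≡.trans (≡.sym (nCk+nC[k+1]≡[n+1]C[k+1] n 1)) (≡.cong (ℕ._+ n C 2) (nC1≡n n))

  module Denominators (x y : Carrier) where
    u d D : ℕ → Carrier
    u n = (1# + x * y) ^ n
    d n = 1# - u n * (x * y)
    D n = product {n} (d ∘ toℕ)

  -- `H` is the state right after a non-closer. Splitting it off and describing it by increments in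
  -- `r` removes the finite sum over s from the recursion.
  module Expansion
    (x y : Carrier) (G H : ℕ → ℕ → Carrier) (D⁻¹ : ℕ → Carrier)
    (G-step : ∀ j r → G j r ≈ 1# + x * H j r)
    (H-zero : ∀ j → H j 0 ≈ 1# + x * H (suc j) (suc j) + y * G j j)
    (H-suc : ∀ j r → H j (suc r) ≈ H j r + y * G j r)
    (D-inverse : ∀ n → Denominators.D x y n * D⁻¹ n ≈ 1#)
    where
    open Denominators x y

    private
      t : Carrier
      t = x * y

      -- One more permitted pick adds one summand, and its continuation is `G j r` itself, because
      -- the new candidate has `r` others below it.
      G-suc : ∀ j r → G j (suc r) ≈ (1# + t) * G j r
      G-suc j r = begin
        G j (suc r)                   ≈⟨ G-step j (suc r) ⟩
        1# + x * H j (suc r)          ≈⟨ +-congˡ (*-congˡ (H-suc j r)) ⟩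
        1# + x * (H j r + y * G j r)  ≈⟨ solve 4 (λ x y h g → con 1 :+ x :* (h :+ y :* g) := (con 1 :+ x :* h) :+ x :* y :* g) refl x y (H j r) (G j r) ⟩
        (1# + x * H j r) + t * G j r  ≈⟨ +-congʳ (G-step j r) ⟨
        G j r + t * G j r             ≈⟨ solve 2 (λ t g → g :+ t :* g := (con 1 :+ t) :* g) refl t (G j r) ⟩
        (1# + t) * G j r              ∎

      G-power : ∀ j r → G j r ≈ u r * G j 0
      G-power j zero    = sym (*-identityˡ (G j 0))
      G-power j (suc r) = begin
        G j (suc r)                 ≈⟨ G-suc j r ⟩
        (1# + t) * G j r            ≈⟨ *-congˡ (G-power j r) ⟩
        (1# + t) * (u r * G j 0)    ≈⟨ *-assoc _ _ _ ⟨
        u (suc r) * G j 0           ∎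

      W : ℕ → Carrier
      W j = 1# + x * G j j

      G-zero : ∀ j → G j 0 ≈ W (suc j) + t * G j j
      G-zero j = begin
        G j 0                             ≈⟨ G-step j 0 ⟩
        1# + x * H j 0                    ≈⟨ +-congˡ (*-congˡ (H-zero j)) ⟩
        1# + x * (1# + x * h + y * G j j)
          ≈⟨ solve 4 (λ x y h g → con 1 :+ x :* (con 1 :+ x :* h :+ y :* g) := (con 1 :+ x :* (con 1 :+ x :* h)) :+ x :* y :* g) refl x y h (G j j) ⟩
        1# + x * (1# + x * h) + t * G j j ≈⟨ +-congʳ (+-congˡ (*-congˡ (G-step (suc j) (suc j)))) ⟨
        W (suc j) + t * G j j             ∎
        where h = H (suc j) (suc j)

      d*G : ∀ j → d j * G j j ≈ u j * W (suc j)
      d*G j = begin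
        (1# - u j * t) * g                       ≈⟨ distribʳ g 1# (- (u j * t)) ⟩
        1# * g + - (u j * t) * g                 ≈⟨ +-cong (*-identityˡ g) (sym (-‿distribˡ-* (u j * t) g)) ⟩
        g - u j * t * g                          ≈⟨ +-congʳ (trans (G-power j j) (*-congˡ (G-zero j))) ⟩
        u j * (w + t * g) - u j * t * g          ≈⟨ +-congʳ (solve 4 (λ u w t g → u :* (w :+ t :* g) := u :* w :+ u :* t :* g) refl (u j) w t g) ⟩
        u j * w + u j * t * g - u j * t * g      ≈⟨ +-assoc _ _ _ ⟩
        u j * w + (u j * t * g - u j * t * g)    ≈⟨ +-congˡ (-‿inverseʳ _) ⟩
        u j * w + 0#                             ≈⟨ +-identityʳ _ ⟩
        u j * w                                  ∎
        where
        g = G j j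
        w = W (suc j)

      -- Both sides are inverses of `D n`, and inverses are unique.
      D⁻¹-suc : ∀ n → D⁻¹ n ≈ d n * D⁻¹ (suc n)
      D⁻¹-suc n = begin
        D⁻¹ n                                ≈⟨ *-identityʳ _ ⟨
        D⁻¹ n * 1#                           ≈⟨ *-congˡ (D-inverse (suc n)) ⟨
        D⁻¹ n * (D (suc n) * D⁻¹ (suc n))    ≈⟨ *-congˡ (*-congʳ (product-last n d)) ⟩
        D⁻¹ n * (D n * d n * D⁻¹ (suc n))    ≈⟨ solve 4 (λ e p d v → e :* (p :* d :* v) := p :* e :* (d :* v)) refl (D⁻¹ n) (D n) (d n) (D⁻¹ (suc n)) ⟩
        D n * D⁻¹ n * (d n * D⁻¹ (suc n))    ≈⟨ *-congʳ (D-inverse n) ⟩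
        1# * (d n * D⁻¹ (suc n))             ≈⟨ *-identityˡ _ ⟩
        d n * D⁻¹ (suc n)                    ∎

      u-suc-C-2 : ∀ n → u (suc n C 2) ≈ u n * u (n C 2)
      u-suc-C-2 n = trans (^-congʳ (1# + t) (suc-C-2 n)) (^-homo-* (1# + t) n (n C 2))

    -- Unrolling at level j contributes a factor x, a factor `u j` and a division by `d j`. After
    -- levels 0 to n - 1 the exponents of 1 + xy add up to `n C 2` and the denominators to `D n`;
    -- `remainder n` is the part not yet unrolled.
    term remainder : ℕ → Carrier
    term n = x ^ n * u (n C 2) * D⁻¹ n
    remainder n = x ^ suc n * (u (n C 2) * D⁻¹ n * G n n)

    private
      remainder-suc : ∀ n → remainder n ≈ term (suc n) + remainder (suc n)
      remainder-suc n = begin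
        xs * (u (n C 2) * D⁻¹ n * G n n)
          ≈⟨ *-congˡ (*-congʳ (*-congˡ (D⁻¹-suc n))) ⟩
        xs * (u (n C 2) * (d n * v) * G n n)
          ≈⟨ solve 5 (λ a b c d e → a :* (b :* (c :* d) :* e) := a :* b :* d :* (c :* e)) refl xs (u (n C 2)) (d n) v (G n n) ⟩
        xs * u (n C 2) * v * (d n * G n n)
          ≈⟨ *-congˡ (d*G n) ⟩
        xs * u (n C 2) * v * (u n * (1# + x * g))
          ≈⟨ solve 6 (λ x xs b v u g → xs :* b :* v :* (u :* (con 1 :+ x :* g)) :=
               xs :* (u :* b) :* v :+ x :* xs :* ((u :* b) :* v :* g)) refl x xs (u (n C 2)) v (u n) g ⟩
        xs * (u n * u (n C 2)) * v + x * xs * (u n * u (n C 2) * v * g)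
          ≈⟨ +-cong (*-congʳ (*-congˡ (u-suc-C-2 n))) (*-congˡ (*-congʳ (*-congʳ (u-suc-C-2 n)))) ⟨
        term (suc n) + remainder (suc n) ∎
        where
        xs = x ^ suc n
        v = D⁻¹ (suc n)
        g = G (suc n) (suc n)

    telescope : ∀ n → x * G 0 0 ≈ sum {n} ((term ∘ suc) ∘ toℕ) + remainder n
    telescope zero = begin
      x * G 0 0                              ≈⟨ *-congˡ (*-identityˡ _) ⟨
      x * (1# * G 0 0)                       ≈⟨ *-congˡ (*-congʳ (D-inverse 0)) ⟨
      x * (1# * D⁻¹ 0 * G 0 0)               ≈⟨ *-congʳ (*-identityʳ x) ⟨
      x * 1# * (1# * D⁻¹ 0 * G 0 0)          ≈⟨ +-identityˡ _ ⟨
      0# + x * 1# * (1# * D⁻¹ 0 * G 0 0)     ∎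
    telescope (suc n) = begin
      x * G 0 0                                         ≈⟨ telescope n ⟩
      s + remainder n                                   ≈⟨ +-congˡ (remainder-suc n) ⟩
      s + (term (suc n) + remainder (suc n))            ≈⟨ +-assoc _ _ _ ⟨
      s + term (suc n) + remainder (suc n)              ≈⟨ +-congʳ (sum-last n (term ∘ suc)) ⟨
      sum {suc n} ((term ∘ suc) ∘ toℕ) + remainder (suc n) ∎
      where s = sum {n} ((term ∘ suc) ∘ toℕ)

-- The ring of power series in two variables

open import Defs
open ≡ using (refl)

-- Power series in x and y are power series in x over the power series in y.
module Series₁ = Convolution ℤₚ.+-*-commutativeRing
module Series₂ = Convolution Series₁.commutativeRing
module S₁ = SemiringSum (CommutativeRing.semiring Series₁.commutativeRing)

sum-apply : ∀ {n} (t : Fin n → ℕ → ℤ) j → S₁.sum t j ≡ ℤ-Sum.sum λ a → t a j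
sum-apply {zero}  t j = refl
sum-apply {suc n} t j = ≡.cong (λ c → t zero j ℤ.+ c) (sum-apply (t ∘ suc) j)

const-zero : ∀ i j → 0# i j ≡ 0ℤ
const-zero zero    zero    = refl
const-zero zero    (suc j) = refl
const-zero (suc i) j       = refl

const-one : ∀ i j → 1# i j ≡ CommutativeRing.1# Series₂.commutativeRing i j
const-one zero    zero    = refl
const-one zero    (suc j) = refl
const-one (suc i) j       = refl

-- The ring axioms are pulled back along the identity. Its homomorphism laws need an argument
-- because the constants are defined by cases on both indices, and because the iterated product adds
-- whole series in y before taking a coefficient.
id-isRingMonomorphism :
  IsRingMonomorphism powerSeries-rawRing (CommutativeRing.rawRing Series₂.commutativeRing) id
id-isRingMonomorphism = record
  { isRingHomomorphism = record
    { isSemiringHomomorphism = record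
      { isNearSemiringHomomorphism = record
        { +-isMonoidHomomorphism = record
          { isMagmaHomomorphism = record
            { isRelHomomorphism = record { cong = id }
            ; homo = λ _ _ _ _ → refl
            }
          ; ε-homo = const-zero
          }
        ; *-homo = λ f g i j →
            ≡.sym (sum-apply {suc i} (λ a → Series₁.conv (f (toℕ a)) (g (i ∸ toℕ a))) j)
        }
      ; 1#-homo = const-one
      }
    ; -‿homo = λ _ _ _ → refl
    }
  ; injective = id
  }

powerSeries-commutativeRing : CommutativeRing 0ℓ 0ℓ
powerSeries-commutativeRing = record
  { isCommutativeRing = RingMono.isCommutativeRing id-isRingMonomorphism
      (CommutativeRing.isCommutativeRing Series₂.commutativeRing)
  }

module PS = CommutativeRing powerSeries-commutativeRing

-- Extracting coefficients

zero-sum : ∀ n (t : Fin n → ℤ) → (∀ a → t a ≡ 0ℤ) → ℤ-Sum.sum t ≡ 0ℤ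
zero-sum n t t≡0 = ≡.trans (ℤ-Sum.sum-cong-≗ t≡0) (ℤ-Sum.sum-replicate-zero n)

*-coeff₀₀ : ∀ f g → (f * g) 0 0 ≡ f 0 0 ℤ.* g 0 0
*-coeff₀₀ f g = ≡.trans (ℤₚ.+-identityʳ _) (ℤₚ.+-identityʳ _)

x*-zero : ∀ f j → (x * f) 0 j ≡ 0ℤ
x*-zero f j = ≡.trans (ℤₚ.+-identityʳ _) (zero-sum (suc j) _ λ _ → refl)

x*-suc : ∀ f i j → (x * f) (suc i) j ≡ f i j
x*-suc f i j = begin
  ℤ-Sum.sum (λ b → t zero b) ℤ.+ (ℤ-Sum.sum (λ b → t (suc zero) b) ℤ.+ ℤ-Sum.sum (λ a → ℤ-Sum.sum (λ b → t (suc (suc a)) b)))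
    -- Only the summand with indices 1 and 0 survives: all other coefficients of `x` are zero.
    ≡⟨ ≡.cong₂ ℤ._+_ (zero-sum (suc j) (t zero) λ _ → refl)
         (≡.cong₂ ℤ._+_
           (≡.cong₂ ℤ._+_ (ℤₚ.*-identityˡ (f i j)) (zero-sum j (λ b → t (suc zero) (suc b)) λ _ → refl))
           (zero-sum i (λ a → ℤ-Sum.sum (t (suc (suc a)))) λ a → zero-sum (suc j) (t (suc (suc a))) λ _ → refl)) ⟩
  0ℤ ℤ.+ (f i j ℤ.+ 0ℤ ℤ.+ 0ℤ)
    ≡⟨ ≡.trans (ℤₚ.+-identityˡ _) (≡.trans (ℤₚ.+-identityʳ _) (ℤₚ.+-identityʳ _)) ⟩
  f i j ∎
  where
  open ≡.≡-Reasoning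
  t : Fin (suc (suc i)) → Fin (suc j) → ℤ
  t a b = x (toℕ a) (toℕ b) ℤ.* f (suc i ∸ toℕ a) (j ∸ toℕ b)

y*-zero : ∀ f i → (y * f) i 0 ≡ 0ℤ
y*-zero f i = zero-sum (suc i) (λ a → ℤ-Sum.sum {1} λ b → y (toℕ a) (toℕ b) ℤ.* f (i ∸ toℕ a) (0 ∸ toℕ b)) λ where
  zero    → refl
  (suc a) → refl

y*-suc : ∀ f i j → (y * f) i (suc j) ≡ f i j
y*-suc f i j = begin
  ℤ-Sum.sum (λ b → t zero b) ℤ.+ ℤ-Sum.sum (λ a → ℤ-Sum.sum (λ b → t (suc a) b))
    ≡⟨ ≡.cong₂ ℤ._+_
         (≡.trans (ℤₚ.+-identityˡ _)
           (≡.cong₂ ℤ._+_ (ℤₚ.*-identityˡ (f i j)) (zero-sum j _ λ _ → refl)))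
         (zero-sum i _ λ _ → zero-sum (suc (suc j)) _ λ _ → refl) ⟩
  f i j ℤ.+ 0ℤ ℤ.+ 0ℤ
    ≡⟨ ≡.trans (ℤₚ.+-identityʳ _) (ℤₚ.+-identityʳ _) ⟩
  f i j ∎
  where
  open ≡.≡-Reasoning
  t : Fin (suc i) → Fin (suc (suc j)) → ℤ
  t a b = y (toℕ a) (toℕ b) ℤ.* f (i ∸ toℕ a) (suc j ∸ toℕ b)

x^*-below : ∀ n f {i} j → i < n → (x ^ n * f) i j ≡ 0ℤ
x^*-below (suc n) f {i} j i<n = ≡.trans (PS.*-assoc x (x ^ n) f i j) (lemma i<n)
  where
  lemma : ∀ {i} → i < suc n → (x * (x ^ n * f)) i j ≡ 0ℤ
  lemma {zero}  _         = x*-zero (x ^ n * f) j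
  lemma {suc i} (s≤s i<n) = ≡.trans (x*-suc (x ^ n * f) i j) (x^*-below n f j i<n)

x^*-shift : ∀ n f i j → (x ^ n * f) (n ℕ.+ i) j ≡ f i j
x^*-shift zero    f i j = PS.*-identityˡ f i j
x^*-shift (suc n) f i j = ≡.trans (PS.*-assoc x (x ^ n) f (suc n ℕ.+ i) j)
  (≡.trans (x*-suc (x ^ n * f) (n ℕ.+ i) j) (x^*-shift n f i j))

y^*-below : ∀ n f i {j} → j < n → (y ^ n * f) i j ≡ 0ℤ
y^*-below (suc n) f i {j} j<n = ≡.trans (PS.*-assoc y (y ^ n) f i j) (lemma j<n)
  where
  lemma : ∀ {j} → j < suc n → (y * (y ^ n * f)) i j ≡ 0ℤ
  lemma {zero}  _         = y*-zero (y ^ n * f) i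
  lemma {suc j} (s≤s j<n) = ≡.trans (y*-suc (y ^ n * f) i j) (y^*-below n f i j<n)

y^*-shift : ∀ n f i j → (y ^ n * f) i (n ℕ.+ j) ≡ f i j
y^*-shift zero    f i j = PS.*-identityˡ f i j
y^*-shift (suc n) f i j = ≡.trans (PS.*-assoc y (y ^ n) f i (suc n ℕ.+ j))
  (≡.trans (y*-suc (y ^ n * f) i (n ℕ.+ j)) (y^*-shift n f i j))

monomial : ℤ → ℕ → ℕ → PowerSeries
monomial c n k = const c * x ^ n * y ^ k

-- With the powers in front, the shift and vanishing lemmas for `x ^ n` and `y ^ k` apply one after
-- the other.
monomial-comm : ∀ c n k → monomial c n k ≈ x ^ n * (y ^ k * const c)
monomial-comm c n k = rotate (const c) (x ^ n) (y ^ k)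
  where
  rotate : ∀ f g h → f * g * h ≈ g * (h * f)
  rotate f g h i j = ≡.trans (PS.*-assoc f g h i j)
    (≡.trans (PS.*-comm f (g * h) i j) (PS.*-assoc g h f i j))

monomial-diag : ∀ c n k → monomial c n k n k ≡ c
monomial-diag c n k = begin
  monomial c n k n k                         ≡⟨ monomial-comm c n k n k ⟩
  (x ^ n * (y ^ k * const c)) n k            ≡⟨ ≡.cong (λ e → (x ^ n * (y ^ k * const c)) e k) (ℕₚ.+-identityʳ n) ⟨
  (x ^ n * (y ^ k * const c)) (n ℕ.+ 0) k    ≡⟨ x^*-shift n (y ^ k * const c) 0 k ⟩
  (y ^ k * const c) 0 k                      ≡⟨ ≡.cong ((y ^ k * const c) 0) (ℕₚ.+-identityʳ k) ⟨
  (y ^ k * const c) 0 (k ℕ.+ 0)              ≡⟨ y^*-shift k (const c) 0 0 ⟩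
  c                                          ∎
  where open ≡.≡-Reasoning

monomial-offˣ : ∀ c n k i j → n ≢ i → monomial c n k i j ≡ 0ℤ
monomial-offˣ c n k i j n≢i = ≡.trans (monomial-comm c n k i j) (helper (n ℕₚ.≤? i))
  where
  helper : _ → (x ^ n * (y ^ k * const c)) i j ≡ 0ℤ
  helper (no n≰i)  = x^*-below n (y ^ k * const c) j (ℕₚ.≰⇒> n≰i)
  helper (yes n≤i) with ℕₚ.m≤n⇒∃[o]m+o≡n n≤i
  ... | zero  , refl = contradiction (≡.sym (ℕₚ.+-identityʳ n)) n≢i
  ... | suc d , refl = ≡.trans (x^*-shift n (y ^ k * const c) (suc d) j) (lemma (k ℕₚ.≤? j))
    where
    lemma : _ → (y ^ k * const c) (suc d) j ≡ 0ℤ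
    lemma (no k≰j)  = y^*-below k (const c) (suc d) (ℕₚ.≰⇒> k≰j)
    lemma (yes k≤j) with ℕₚ.m≤n⇒∃[o]m+o≡n k≤j
    ... | e , refl = y^*-shift k (const c) (suc d) e

monomial-offʸ : ∀ c n k i j → k ≢ j → monomial c n k i j ≡ 0ℤ
monomial-offʸ c n k i j k≢j with n ℕₚ.≟ i
... | no n≢i     = monomial-offˣ c n k i j n≢i
... | yes refl = ≡.trans (monomial-comm c n k n j)
  (≡.trans (≡.cong (λ e → (x ^ n * (y ^ k * const c)) e j) (≡.sym (ℕₚ.+-identityʳ n)))
    (≡.trans (x^*-shift n (y ^ k * const c) 0 j) (lemma (k ℕₚ.≤? j))))
  where
  lemma : _ → (y ^ k * const c) 0 j ≡ 0ℤ
  lemma (no k≰j)  = y^*-below k (const c) 0 (ℕₚ.≰⇒> k≰j)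
  lemma (yes k≤j) with ℕₚ.m≤n⇒∃[o]m+o≡n k≤j
  ... | zero  , refl = contradiction (≡.sym (ℕₚ.+-identityʳ k)) k≢j
  ... | suc e , refl = ≡.trans (y^*-shift k (const c) 0 (suc e)) refl

sum<-zero : ∀ n f i j → (∀ k → k < n → f k i j ≡ 0ℤ) → sum< n f i j ≡ 0ℤ
sum<-zero zero    f zero    zero    _   = refl
sum<-zero zero    f zero    (suc j) _   = refl
sum<-zero zero    f (suc i) j       _   = refl
sum<-zero (suc n) f i       j       f≡0 =
  ≡.cong₂ ℤ._+_ (f≡0 0 (s≤s z≤n)) (sum<-zero n (f ∘ suc) i j λ k k<n → f≡0 (suc k) (s≤s k<n))

sum<-single : ∀ n f i j {k} → k < n → (∀ l → l ≢ k → f l i j ≡ 0ℤ) → sum< n f i j ≡ f k i j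
sum<-single (suc n) f i j {zero}  _         f≡0 = ≡.trans
  (≡.cong (λ e → f 0 i j ℤ.+ e) (sum<-zero n (f ∘ suc) i j λ l _ → f≡0 (suc l) λ ()))
  (ℤₚ.+-identityʳ _)
sum<-single (suc n) f i j {suc k} (s≤s k<n) f≡0 = ≡.trans
  (≡.cong₂ ℤ._+_ (f≡0 0 λ ()) (sum<-single n (f ∘ suc) i j k<n λ l l≢k → f≡0 (suc l) (l≢k ∘ ℕₚ.suc-injective)))
  (ℤₚ.+-identityˡ _)

product<-coeff₀₀ : ∀ n f → (∀ k → f k 0 0 ≡ 1ℤ) → product< n f 0 0 ≡ 1ℤ
product<-coeff₀₀ zero    f f≡1 = refl
product<-coeff₀₀ (suc n) f f≡1 = ≡.trans (*-coeff₀₀ (f 0) (product< n (f ∘ suc)))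
  (≡.cong₂ ℤ._*_ (f≡1 0) (product<-coeff₀₀ n (f ∘ suc) (f≡1 ∘ suc)))

-- The counting recursion and its generating functions

sumUpTo : ℕ → (ℕ → ℕ) → ℕ
sumUpTo zero    f = 0
sumUpTo (suc n) f = sumUpTo n f ℕ.+ f n

-- The number of ways to append a non-closers and b closers to a prefix with j
-- unpicked non-closers.  In `closedCount` the prefix is empty or ends in a
-- closer, and r of the j may be picked right after the next non-closer.  In
-- `openCount` the prefix ends in a non-closer, which is not included in j and
-- may always be picked next, as may r of the j.
closedCount openCount : (j r a b : ℕ) → ℕ

closedCount j r zero    zero    = 1
closedCount j r zero    (suc b) = 0
closedCount j r (suc a) b       = openCount j r a b

openCount j r zero    zero    = 1
openCount j r (suc a) zero    = openCount (suc j) (suc j) a zero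
openCount j r zero    (suc b) = closedCount j j zero b ℕ.+ sumUpTo r λ s → closedCount j s zero b
openCount j r (suc a) (suc b) =
  openCount (suc j) (suc j) a (suc b) ℕ.+ (closedCount j j (suc a) b ℕ.+ sumUpTo r λ s → closedCount j s (suc a) b)

sumUpTo-zero : ∀ n f → (∀ k → f k ≡ 0) → sumUpTo n f ≡ 0
sumUpTo-zero zero    f f≡0 = refl
sumUpTo-zero (suc n) f f≡0 = ≡.cong₂ ℕ._+_ (sumUpTo-zero n f f≡0) (f≡0 n)

-- Every closer directly follows a non-closer, so however large `j` is, the appended closers need
-- distinct appended non-closers. In the open state the end of the prefix supplies one more, hence
-- `suc a`.
closedCount-vanish : ∀ j r a b → a < b → closedCount j r a b ≡ 0
openCount-vanish : ∀ j r a b → suc a < b → openCount j r a b ≡ 0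

closedCount-vanish j r zero    (suc b) _   = refl
closedCount-vanish j r (suc a) b       a<b = openCount-vanish j r a b a<b

openCount-vanish j r zero    (suc b) (s≤s a<b) = ≡.cong₂ ℕ._+_
  (closedCount-vanish j j 0 b a<b)
  (sumUpTo-zero r _ λ s → closedCount-vanish j s 0 b a<b)
openCount-vanish j r (suc a) (suc b) (s≤s a<b) = ≡.cong₂ ℕ._+_
  (openCount-vanish (suc j) (suc j) a (suc b) (ℕₚ.m≤n⇒m≤1+n a<b))
  (≡.cong₂ ℕ._+_ (closedCount-vanish j j (suc a) b a<b)
    (sumUpTo-zero r _ λ s → closedCount-vanish j s (suc a) b a<b))

t : PowerSeries
t = x * y

G H : ℕ → ℕ → PowerSeries
G j r a b = + closedCount j r a b
H j r a b = + openCount j r a b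

G-step : ∀ j r → G j r ≈ 1# + x * H j r
G-step j r zero    zero    = ≡.sym (≡.cong (λ e → 1ℤ ℤ.+ e) (x*-zero (H j r) 0))
G-step j r zero    (suc b) = ≡.sym (≡.cong (λ e → 0ℤ ℤ.+ e) (x*-zero (H j r) (suc b)))
G-step j r (suc a) b       = ≡.sym (≡.trans (ℤₚ.+-identityˡ _) (x*-suc (H j r) a b))

H-zero : ∀ j → H j 0 ≈ (1# + x * H (suc j) (suc j)) + y * G j j
H-zero j zero    zero    = ≡.sym (≡.cong₂ (λ d e → 1ℤ ℤ.+ d ℤ.+ e) (x*-zero (H (suc j) (suc j)) 0) (y*-zero (G j j) 0))
H-zero j (suc a) zero    = ≡.sym (≡.trans
  (≡.cong₂ (λ d e → 0ℤ ℤ.+ d ℤ.+ e) (x*-suc (H (suc j) (suc j)) a 0) (y*-zero (G j j) (suc a)))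
  (≡.trans (ℤₚ.+-identityʳ _) (ℤₚ.+-identityˡ _)))
H-zero j zero    (suc b) = ≡.sym (≡.trans
  (≡.cong₂ (λ d e → 0ℤ ℤ.+ d ℤ.+ e) (x*-zero (H (suc j) (suc j)) (suc b)) (y*-suc (G j j) 0 b))
  (≡.cong +_ (≡.sym (ℕₚ.+-identityʳ (closedCount j j 0 b)))))
H-zero j (suc a) (suc b) = ≡.sym (≡.trans
  (≡.cong₂ (λ d e → 0ℤ ℤ.+ d ℤ.+ e) (x*-suc (H (suc j) (suc j)) a (suc b)) (y*-suc (G j j) (suc a) b))
  (≡.cong (λ e → + (openCount (suc j) (suc j) a (suc b) ℕ.+ e)) (≡.sym (ℕₚ.+-identityʳ (closedCount j j (suc a) b)))))

H-suc : ∀ j r → H j (suc r) ≈ H j r + y * G j r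
H-suc j r zero    zero    = ≡.sym (≡.cong (λ e → 1ℤ ℤ.+ e) (y*-zero (G j r) 0))
H-suc j r (suc a) zero    = ≡.sym (≡.trans
  (≡.cong (λ e → H j r (suc a) 0 ℤ.+ e) (y*-zero (G j r) (suc a)))
  (ℤₚ.+-identityʳ _))
H-suc j r zero    (suc b) = ≡.sym (≡.trans
  (≡.cong (λ e → H j r 0 (suc b) ℤ.+ e) (y*-suc (G j r) 0 b))
  (≡.cong +_ (ℕₚ.+-assoc (closedCount j j 0 b) _ _)))
H-suc j r (suc a) (suc b) = ≡.sym (≡.trans
  (≡.cong (λ e → H j r (suc a) (suc b) ℤ.+ e) (y*-suc (G j r) (suc a) b))
  (≡.cong +_ (≡.trans (ℕₚ.+-assoc (openCount (suc j) (suc j) a (suc b)) _ _)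
    (≡.cong (openCount (suc j) (suc j) a (suc b) ℕ.+_) (ℕₚ.+-assoc (closedCount j j (suc a) b) _ _)))))

d : ℕ → PowerSeries
d n = 1# - (1# + t) ^ n * t

d-coeff₀₀ : ∀ n → d n 0 0 ≡ 1ℤ
d-coeff₀₀ n = ≡.cong (λ e → 1ℤ ℤ.- e)
  (≡.trans (*-coeff₀₀ ((1# + t) ^ n) t) (ℤₚ.*-zeroʳ (((1# + t) ^ n) 0 0)))

D⁻¹ : ℕ → PowerSeries
D⁻¹ n = product< n d ⁻¹

D-inverse : ∀ n → product< n d * D⁻¹ n ≈ 1#
D-inverse n = *-inverseʳ (product< n d) (product<-coeff₀₀ n d d-coeff₀₀)

open Telescope.Expansion powerSeries-commutativeRing x y G H D⁻¹ G-step H-zero H-suc D-inverse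

-- Convergence of both sides

-- The factor `x` turns the number a of non-closers into the summation index n = a + 1, in agreement
-- with m = n + k - 1 = a + k.
S : PowerSeries
S = x * G 0 0

-- The remainder after M terms is divisible by `x ^ suc M`, so the coefficients at xⁱ are final from
-- M = i on.
rhs-converges : ∑[n≥1] term ⟶ S
rhs-converges i j = i , λ M i≤M → ≡.sym (begin
  S i j                                                ≡⟨ telescope M i j ⟩
  (∑[ n < M ] term (suc n)) i j ℤ.+ remainder M i j    ≡⟨ ≡.cong (λ e → (∑[ n < M ] term (suc n)) i j ℤ.+ e) (x^*-below (suc M) ((1# + t) ^ (M C 2) * product< M d ⁻¹ * G M M) j (s≤s i≤M)) ⟩
  (∑[ n < M ] term (suc n)) i j ℤ.+ 0ℤ                 ≡⟨ ℤₚ.+-identityʳ _ ⟩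
  (∑[ n < M ] term (suc n)) i j                        ∎)
  where open ≡.≡-Reasoning

-- The summand with indices n and k is a single monomial, so at most one of them reaches a given
-- coefficient.
lhs-converges : (∀ a k → P (a ℕ.+ k) k ≡ closedCount 0 0 a k) →
  ∑[n≥1] (λ n → ∑[ k < n ] (const (+ P (n ℕ.+ k ∸ 1) k) * x ^ n * y ^ k)) ⟶ S
lhs-converges P≡closedCount i j = i , λ M i≤M → limit i M i≤M
  where
  f : ℕ → ℕ → PowerSeries
  f n k = monomial (+ P (n ℕ.+ k ∸ 1) k) n k

  limit : ∀ i M → i ≤ M → (∑[ n < M ] ∑[ k < suc n ] f (suc n) k) i j ≡ S i j
  limit zero M _ = ≡.trans
    (sum<-zero M (λ n → ∑[ k < suc n ] f (suc n) k) 0 j λ n _ →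
      sum<-zero (suc n) (f (suc n)) 0 j λ k _ → monomial-offˣ (+ P (n ℕ.+ k) k) (suc n) k 0 j λ ())
    (≡.sym (x*-zero (G 0 0) j))
  limit (suc a) M a<M = ≡.trans
    (sum<-single M (λ n → ∑[ k < suc n ] f (suc n) k) (suc a) j a<M λ n n≢a →
      sum<-zero (suc n) (f (suc n)) (suc a) j λ k _ →
        monomial-offˣ (+ P (n ℕ.+ k) k) (suc n) k (suc a) j (n≢a ∘ ℕₚ.suc-injective))
    (≡.trans (inner (j ℕₚ.≤? a)) (≡.sym (x*-suc (G 0 0) a j)))
    where
    inner : _ → (∑[ k < suc a ] f (suc a) k) (suc a) j ≡ + closedCount 0 0 a j
    inner (yes j≤a) = ≡.trans
      (sum<-single (suc a) (f (suc a)) (suc a) j (s≤s j≤a) λ k k≢j →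
        monomial-offʸ (+ P (a ℕ.+ k) k) (suc a) k (suc a) j k≢j)
      (≡.trans (monomial-diag (+ P (a ℕ.+ j) j) (suc a) j) (≡.cong +_ (P≡closedCount a j)))
    -- The inner sum stops before k = j. Nothing is lost, since there would be more closers than
    -- non-closers.
    inner (no j≰a) = ≡.trans
      (sum<-zero (suc a) (f (suc a)) (suc a) j λ k k≤a →
        monomial-offʸ (+ P (a ℕ.+ k) k) (suc a) k (suc a) j λ { refl → j≰a (ℕₚ.≤-pred k≤a) })
      (≡.cong +_ (≡.sym (closedCount-vanish 0 0 a j (ℕₚ.≰⇒> j≰a))))

-- Ranks in decreasing lists

below without : ℕ → List ℕ → List ℕ
below   a = filter (ℕₚ._<? a)
without a = filter (λ u → ¬? (u ℕₚ.≟ a))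

Decreasing : List ℕ → Set
Decreasing = AllPairs _>_

without-fresh : ∀ {a us} → All (_< a) us → without a us ≡ us
without-fresh us<a = Listₚ.filter-all _ (All.map ℕₚ.<⇒≢ us<a)

below-all : ∀ {a us} → All (_< a) us → below a us ≡ us
below-all = Listₚ.filter-all _

below-∷ : ∀ a us → below a (a ∷ us) ≡ below a us
below-∷ a us = Listₚ.filter-reject (ℕₚ._<? a) (ℕₚ.<-irrefl refl)

below-above : ∀ {a u} us → a < u → below a (u ∷ us) ≡ below a us
below-above {a} us a<u = Listₚ.filter-reject (ℕₚ._<? a) (ℕₚ.<-asym a<u)

below-∷-cong : ∀ a u {us vs} → below a us ≡ below a vs → below a (u ∷ us) ≡ below a (u ∷ vs)
below-∷-cong a u {us} {vs} eq with u ℕₚ.<? a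
... | yes u<a = ≡.trans (Listₚ.filter-accept (ℕₚ._<? a) u<a)
  (≡.trans (≡.cong (u ∷_) eq) (≡.sym (Listₚ.filter-accept (ℕₚ._<? a) u<a)))
... | no  u≮a = ≡.trans (Listₚ.filter-reject (ℕₚ._<? a) u≮a)
  (≡.trans eq (≡.sym (Listₚ.filter-reject (ℕₚ._<? a) u≮a)))

below-without : ∀ a us → below a (without a us) ≡ below a us
below-without a []       = refl
below-without a (u ∷ us) with u ℕₚ.≟ a
... | yes refl = ≡.trans
  (≡.cong (below a) (Listₚ.filter-reject (λ v → ¬? (v ℕₚ.≟ a)) (λ a≢a → a≢a refl)))
  (≡.trans (below-without a us) (≡.sym (below-∷ a us)))
... | no u≢a = ≡.trans
  (≡.cong (below a) (Listₚ.filter-accept (λ v → ¬? (v ℕₚ.≟ a)) u≢a))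
  (below-∷-cong a u (below-without a us))

below-below : ∀ {a b} us → a ≤ b → below a (below b us) ≡ below a us
below-below         []       a≤b = refl
below-below {a} {b} (u ∷ us) a≤b with u ℕₚ.<? b
... | yes u<b = ≡.trans (≡.cong (below a) (Listₚ.filter-accept (ℕₚ._<? b) u<b))
  (below-∷-cong a u (below-below us a≤b))
... | no u≮b = ≡.trans (≡.cong (below a) (Listₚ.filter-reject (ℕₚ._<? b) u≮b))
  (≡.trans (below-below us a≤b)
    (≡.sym (Listₚ.filter-reject (ℕₚ._<? a) λ u<a → u≮b (ℕₚ.<-≤-trans u<a a≤b))))

length-without : ∀ {a us} → Decreasing us → a ∈ us → suc (length (without a us)) ≡ length us
length-without {a} {u ∷ us} (u> ∷ _) (here refl) = ≡.cong (suc ∘ length)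
  (≡.trans (Listₚ.filter-reject (λ v → ¬? (v ℕₚ.≟ a)) (λ a≢a → a≢a refl)) (without-fresh u>))
length-without {a} {u ∷ us} (u> ∷ us↓) (there a∈us) = ≡.cong suc
  (≡.trans (≡.cong length (Listₚ.filter-accept (λ v → ¬? (v ℕₚ.≟ a)) (ℕₚ.>⇒≢ (All.lookup u> a∈us))))
    (length-without us↓ a∈us))

-- In a strictly decreasing list the number of smaller entries takes each value below the length
-- exactly once. A sum over picks thus becomes the sum over s in the recursion.
sum-by-rank : ∀ F {us} → Decreasing us →
  Listℕ.sum (map (λ a → F (length (below a us))) us) ≡ sumUpTo (length us) F
sum-by-rank F {[]}     _          = refl
sum-by-rank F {u ∷ us} (u> ∷ us↓) = begin
  F (length (below u (u ∷ us))) ℕ.+ Listℕ.sum (map (λ a → F (length (below a (u ∷ us)))) us)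
    ≡⟨ ≡.cong₂ ℕ._+_
         (≡.cong (F ∘ length) (≡.trans (below-∷ u us) (below-all u>)))
         (≡.cong Listℕ.sum (Listₚ.map-cong-local (All.map (≡.cong (F ∘ length) ∘ below-above us) u>))) ⟩
  F (length us) ℕ.+ Listℕ.sum (map (λ a → F (length (below a us))) us)
    ≡⟨ ≡.cong (F (length us) ℕ.+_) (sum-by-rank F us↓) ⟩
  F (length us) ℕ.+ sumUpTo (length us) F
    ≡⟨ ℕₚ.+-comm (F (length us)) _ ⟩
  sumUpTo (length us) F ℕ.+ F (length us) ∎
  where open ≡.≡-Reasoning

-- A matching is coded by its letters in reverse order: the letter at position
-- j is `just i` if (i , j) is an arc, and `nothing` if j closes no arc.
Code : Set
Code = List (Maybe ℕ)

-- `options c` are the possible openers for a closer at position `length c`.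
unpicked permitted options : Code → List ℕ

unpicked []            = []
unpicked (nothing ∷ c) = length c ∷ unpicked c
unpicked (just i  ∷ c) = without i (unpicked c)

-- The openers strictly before position `length c` that a closer at
-- position `1 + length c` may pick.
permitted []              = []
permitted (nothing ∷ c)   = unpicked (nothing ∷ c)
permitted c@(just i ∷ _)  = below i (unpicked c)

options []            = []
options (nothing ∷ c) = length c ∷ permitted c
options (just _  ∷ _) = []

Valid : Code → Set
Valid []            = ⊤
Valid (nothing ∷ c) = Valid c
Valid (just i  ∷ c) = i ∈ options c × Valid c

unpicked-bounded : ∀ c → All (_< length c) (unpicked c)
unpicked-bounded []            = []
unpicked-bounded (nothing ∷ c) = ℕₚ.≤-refl ∷ All.map ℕₚ.m<n⇒m<1+n (unpicked-bounded c)
unpicked-bounded (just i  ∷ c) = Allₚ.filter⁺ _ (All.map ℕₚ.m<n⇒m<1+n (unpicked-bounded c))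

unpicked-decreasing : ∀ c → Decreasing (unpicked c)
unpicked-decreasing []            = []
unpicked-decreasing (nothing ∷ c) = unpicked-bounded c ∷ unpicked-decreasing c
unpicked-decreasing (just i  ∷ c) = AllPairsₚ.filter⁺ _ (unpicked-decreasing c)

permitted⊆unpicked : ∀ c {i} → i ∈ permitted c → i ∈ unpicked c
permitted⊆unpicked (nothing ∷ c) i∈ = i∈
permitted⊆unpicked (just a  ∷ c) i∈ = proj₁ (∈ₚ.∈-filter⁻ (ℕₚ._<? a) i∈)

permitted-decreasing : ∀ c → Decreasing (permitted c)
permitted-decreasing []              = []
permitted-decreasing (nothing ∷ c)   = unpicked-decreasing (nothing ∷ c)
permitted-decreasing c@(just a  ∷ _) = AllPairsₚ.filter⁺ (ℕₚ._<? a) (unpicked-decreasing c)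

below-permitted : ∀ c {i} → i ∈ permitted c → below i (permitted c) ≡ below i (unpicked c)
below-permitted (nothing ∷ c)    i∈ = refl
below-permitted c@(just a  ∷ _)  i∈ =
  below-below (unpicked c) (ℕₚ.<⇒≤ (proj₂ (∈ₚ.∈-filter⁻ (ℕₚ._<? a) {xs = unpicked c} i∈)))

options-unique : ∀ c → Unique (options c)
options-unique []            = []
options-unique (just _  ∷ _) = []
options-unique (nothing ∷ c) = AllPairs.map ℕₚ.>⇒≢
  (All.tabulate (All.lookup (unpicked-bounded c) ∘ permitted⊆unpicked c) ∷ permitted-decreasing c)

-- Counting the words of picks

extensions : ℕ → ℕ → Code → List Code
extensions zero    zero    c = c ∷ []
extensions (suc a) zero    c = extensions a zero (nothing ∷ c)
extensions zero    (suc b) c = concatMap (λ i → extensions zero b (just i ∷ c)) (options c)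
extensions (suc a) (suc b) c =
  extensions a (suc b) (nothing ∷ c) ++ concatMap (λ i → extensions (suc a) b (just i ∷ c)) (options c)

length-concatMap : ∀ {A B : Set} (f : A → List B) xs →
  length (concatMap f xs) ≡ Listℕ.sum (map (length ∘ f) xs)
length-concatMap f []       = refl
length-concatMap f (x ∷ xs) =
  ≡.trans (Listₚ.length-++ (f x)) (≡.cong (length (f x) ℕ.+_) (length-concatMap f xs))

unpicked-diagonal : ∀ c → unpicked (just (length c) ∷ nothing ∷ c) ≡ unpicked c
unpicked-diagonal c = ≡.trans
  (Listₚ.filter-reject (λ v → ¬? (v ℕₚ.≟ length c)) (λ a≢a → a≢a refl))
  (without-fresh (unpicked-bounded c))

unpicked-old : ∀ c {i} → i ∈ unpicked c →
  unpicked (just i ∷ nothing ∷ c) ≡ length c ∷ without i (unpicked c)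
unpicked-old c {i} i∈ = Listₚ.filter-accept (λ v → ¬? (v ℕₚ.≟ i))
  (ℕₚ.>⇒≢ (All.lookup (unpicked-bounded c) i∈))

free allowed : Code → ℕ
free    c = length (unpicked c)
allowed c = length (permitted c)

free-diagonal : ∀ c → free (just (length c) ∷ nothing ∷ c) ≡ free c
free-diagonal c = ≡.cong length (unpicked-diagonal c)

-- All other unpicked positions lie below an adjacent opener, so the cut at the pick removes
-- nothing.
allowed-diagonal : ∀ c → allowed (just (length c) ∷ nothing ∷ c) ≡ free c
allowed-diagonal c = ≡.cong length
  (≡.trans (≡.cong (below (length c)) (unpicked-diagonal c)) (below-all (unpicked-bounded c)))

-- The picked opener leaves the list and the neighbour that was passed over enters it.
free-old : ∀ c {i} → i ∈ permitted c → free (just i ∷ nothing ∷ c) ≡ free c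
free-old c i∈ = ≡.trans (≡.cong length (unpicked-old c i∈u)) (length-without (unpicked-decreasing c) i∈u)
  where i∈u = permitted⊆unpicked c i∈

-- The neighbour `length c` lies above the pick and is cut off. `permitted c` is itself a lower part
-- of `unpicked c`, so both have the same entries below the pick, and the rank of the pick becomes
-- the next `r`.
allowed-old : ∀ c {i} → i ∈ permitted c →
  allowed (just i ∷ nothing ∷ c) ≡ length (below i (permitted c))
allowed-old c {i} i∈ = ≡.cong length (begin
  below i (unpicked (just i ∷ nothing ∷ c))       ≡⟨ ≡.cong (below i) (unpicked-old c i∈u) ⟩
  below i (length c ∷ without i (unpicked c))     ≡⟨ below-above _ (All.lookup (unpicked-bounded c) i∈u) ⟩
  below i (without i (unpicked c))                ≡⟨ below-without i (unpicked c) ⟩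
  below i (unpicked c)                            ≡⟨ below-permitted c i∈ ⟨
  below i (permitted c)                           ∎)
  where
  open ≡.≡-Reasoning
  i∈u = permitted⊆unpicked c i∈

count-start : ∀ a b → length (extensions a b []) ≡ closedCount 0 0 a b
count-after-closer : ∀ a b i c →
  length (extensions a b (just i ∷ c)) ≡ closedCount (free (just i ∷ c)) (allowed (just i ∷ c)) a b
count-after-opener : ∀ a b c → length (extensions a b (nothing ∷ c)) ≡ openCount (free c) (allowed c) a b

-- The adjacent pick heads `options` and gives the first summand; the remaining picks are summed by
-- rank.
count-picks : ∀ a b c → length (concatMap (λ i → extensions a b (just i ∷ nothing ∷ c)) (options (nothing ∷ c)))
  ≡ closedCount (free c) (free c) a b ℕ.+ sumUpTo (allowed c) λ s → closedCount (free c) s a b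

count-start zero    zero    = refl
count-start zero    (suc b) = refl
count-start (suc a) zero    = count-after-opener a 0 []
count-start (suc a) (suc b) = ≡.trans (≡.cong length (Listₚ.++-identityʳ (extensions a (suc b) (nothing ∷ []))))
  (count-after-opener a (suc b) [])

count-after-closer zero    zero    i c = refl
count-after-closer zero    (suc b) i c = refl
count-after-closer (suc a) zero    i c = count-after-opener a 0 (just i ∷ c)
count-after-closer (suc a) (suc b) i c = ≡.trans
  (≡.cong length (Listₚ.++-identityʳ (extensions a (suc b) (nothing ∷ just i ∷ c))))
  (count-after-opener a (suc b) (just i ∷ c))

count-after-opener zero    zero    c = refl
count-after-opener (suc a) zero    c = count-after-opener a 0 (nothing ∷ c)
count-after-opener zero    (suc b) c = count-picks 0 b c
count-after-opener (suc a) (suc b) c = ≡.trans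
  (Listₚ.length-++ (extensions a (suc b) (nothing ∷ nothing ∷ c)))
  (≡.cong₂ ℕ._+_ (count-after-opener a (suc b) (nothing ∷ c)) (count-picks (suc a) b c))

count-picks a b c = begin
  length (concatMap (λ i → extensions a b (just i ∷ nothing ∷ c)) (options (nothing ∷ c)))
    ≡⟨ length-concatMap (λ i → extensions a b (just i ∷ nothing ∷ c)) (options (nothing ∷ c)) ⟩
  size (length c) ℕ.+ Listℕ.sum (map size (permitted c))
    ≡⟨ ≡.cong₂ ℕ._+_
         (≡.trans (count-after-closer a b (length c) (nothing ∷ c))
           (≡.cong₂ (λ j r → closedCount j r a b) (free-diagonal c) (allowed-diagonal c)))
         (≡.cong Listℕ.sum (Listₚ.map-cong-local (All.tabulate λ {i} i∈ →
           ≡.trans (count-after-closer a b i (nothing ∷ c))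
             (≡.cong₂ (λ j r → closedCount j r a b) (free-old c i∈) (allowed-old c i∈))))) ⟩
  closedCount (free c) (free c) a b ℕ.+
    Listℕ.sum (map (λ i → closedCount (free c) (length (below i (permitted c))) a b) (permitted c))
    ≡⟨ ≡.cong (closedCount (free c) (free c) a b ℕ.+_)
         (sum-by-rank (λ s → closedCount (free c) s a b) (permitted-decreasing c)) ⟩
  closedCount (free c) (free c) a b ℕ.+ sumUpTo (allowed c) (λ s → closedCount (free c) s a b) ∎
  where
  open ≡.≡-Reasoning
  size : ℕ → ℕ
  size i = length (extensions a b (just i ∷ nothing ∷ c))

-- Valid codes are those without forbidden patterns

Linked : Code → ℕ → ℕ → Set
Linked []      i j = ⊥
Linked (l ∷ c) i j = (l ≡ just i × j ≡ length c) ⊎ Linked c i j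

-- This is the common ground of families and codes. `uniqueˡ`, `uniqueʳ` and `unchained` say
-- together that distinct arcs share no endpoint. As `A` occurs only in hypotheses, the property
-- passes to subrelations, which permits removing letters one by one.
record Admissible (A : ℕ → ℕ → Set) : Set where
  field
    ordered   : ∀ {i j} → A i j → i < j
    uniqueˡ   : ∀ {i i′ j} → A i j → A i′ j → i ≡ i′
    uniqueʳ   : ∀ {i j j′} → A i j → A i j′ → j ≡ j′
    unchained : ∀ {i j k} → A i j → ¬ A j k
    uncrossed : ∀ {i j i′ j′} → A i j → A i′ j′ → i < i′ → i′ < j → j < j′ → ¬ j′ ≤ 2 ℕ.+ j
    unnested  : ∀ {i j i′ j′} → A i j → A i′ j′ → i < i′ → i′ < j′ → j ≢ suc j′

linked-bound : ∀ c {i j} → Linked c i j → j < length c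
linked-bound (l ∷ c) (inj₁ (_ , refl)) = ℕₚ.≤-refl
linked-bound (l ∷ c) (inj₂ a)          = ℕₚ.m<n⇒m<1+n (linked-bound c a)

linked-last : ∀ {l c i} → Linked (l ∷ c) i (length c) → l ≡ just i
linked-last         (inj₁ (eq , _)) = eq
linked-last {c = c} (inj₂ a)        = contradiction (linked-bound c a) (ℕₚ.<-irrefl refl)

-- In an arbitrary code a letter may name a position at or after its own. Such a letter could use an
-- opener that is only listed later, so the second half assumes that arcs are ordered.
unpicked-sound : ∀ c {u} → u ∈ unpicked c →
  (∀ {i} → ¬ Linked c i u) × ((∀ {i j} → Linked c i j → i < j) → ∀ {j} → ¬ Linked c u j)
unpicked-sound (nothing ∷ c) (here refl) =
  (λ { (inj₂ a) → ℕₚ.<-irrefl refl (linked-bound c a) }) ,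
  (λ { ord {j} (inj₂ a) → ℕₚ.<-asym (ord (inj₂ a)) (linked-bound c a) })
unpicked-sound (nothing ∷ c) (there u∈) with unpicked-sound c u∈
... | closes , opens = (λ { (inj₂ a) → closes a }) , (λ { ord (inj₂ a) → opens (ord ∘ inj₂) a })
unpicked-sound (just i ∷ c) {u} u∈ with ∈ₚ.∈-filter⁻ (λ v → ¬? (v ℕₚ.≟ i)) u∈
... | u∈c , u≢i with unpicked-sound c u∈c
...   | closes , opens =
  (λ { (inj₁ (_ , refl)) → ℕₚ.<-irrefl refl (All.lookup (unpicked-bounded c) u∈c) ; (inj₂ a) → closes a }) ,
  (λ { ord (inj₁ (eq , _)) → u≢i (≡.sym (just-injective eq)) ; ord (inj₂ a) → opens (ord ∘ inj₂) a })

unpicked-complete : ∀ c {u} → u < length c → (∀ {i} → ¬ Linked c i u) → (∀ {j} → ¬ Linked c u j) → u ∈ unpicked c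
unpicked-complete (l ∷ c) {u} u< closes opens with u ℕₚ.≟ length c
unpicked-complete (nothing ∷ c) {u} u< closes opens | yes refl = here refl
unpicked-complete (just i  ∷ c) {u} u< closes opens | yes refl = ⊥-elim (closes (inj₁ (refl , refl)))
unpicked-complete (l ∷ c) {u} u< closes opens | no u≢
  with unpicked-complete c (ℕₚ.≤∧≢⇒< (ℕₚ.≤-pred u<) u≢) (closes ∘ inj₂) (opens ∘ inj₂)
unpicked-complete (nothing ∷ c) u< closes opens | no _ | u∈c = there u∈c
unpicked-complete (just i  ∷ c) u< closes opens | no _ | u∈c =
  ∈ₚ.∈-filter⁺ _ u∈c λ { refl → opens (inj₁ (refl , refl)) }

admissible-antitone : ∀ {A B : ℕ → ℕ → Set} → (∀ {i j} → B i j → A i j) → Admissible A → Admissible B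
admissible-antitone B⊆A adm = record
  { ordered   = ordered ∘ B⊆A
  ; uniqueˡ   = λ a b → uniqueˡ (B⊆A a) (B⊆A b)
  ; uniqueʳ   = λ a b → uniqueʳ (B⊆A a) (B⊆A b)
  ; unchained = λ a b → unchained (B⊆A a) (B⊆A b)
  ; uncrossed = λ a b → uncrossed (B⊆A a) (B⊆A b)
  ; unnested  = λ a b → unnested (B⊆A a) (B⊆A b)
  } where open Admissible adm

options⊆unpicked : ∀ c {i} → i ∈ options c → i ∈ unpicked c
options⊆unpicked (nothing ∷ c) (here i≡)  = here i≡
options⊆unpicked (nothing ∷ c) (there i∈) = there (permitted⊆unpicked c i∈)

no-adjacent-closer : ∀ c {i a j} → i ∈ options c → Linked c a j → suc j ≢ length c
no-adjacent-closer (nothing ∷ c) i∈ (inj₂ a) eq =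
  ℕₚ.<-irrefl (ℕₚ.suc-injective eq) (linked-bound c a)

-- One non-closer separates the two closers. If it is the pick, the new arc starts after `j`; any
-- other pick comes from `permitted`, which was cut at `a`.
no-crossing-pick : ∀ c {i a j} → i ∈ options c → Linked c a j → 2 ℕ.+ j ≡ length c → a < i → ¬ i < j
no-crossing-pick (nothing ∷ c) (here refl) (inj₂ a) eq _ c<j = ℕₚ.<-asym c<j (linked-bound c a)
no-crossing-pick (nothing ∷ l ∷ c) (there i∈) (inj₂ a) refl a<i _ with linked-last a
... | refl = ℕₚ.<-asym a<i (proj₂ (∈ₚ.∈-filter⁻ (ℕₚ._<? _) {xs = unpicked (l ∷ c)} i∈))

admissible-extend : ∀ c i → Admissible (Linked c) → i ∈ options c → Admissible (Linked (just i ∷ c))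
admissible-extend c i adm i∈ = record
  { ordered = λ where
      (inj₁ (refl , refl)) → i<
      (inj₂ a)             → ordered a
  ; uniqueˡ = λ where
      (inj₁ (refl , _))    (inj₁ (refl , _))    → refl
      (inj₁ (_ , refl))    (inj₂ b)             → contradiction (linked-bound c b) (ℕₚ.<-irrefl refl)
      (inj₂ a)             (inj₁ (_ , refl))    → contradiction (linked-bound c a) (ℕₚ.<-irrefl refl)
      (inj₂ a)             (inj₂ b)             → uniqueˡ a b
  ; uniqueʳ = λ where
      (inj₁ (_ , refl))    (inj₁ (_ , refl))    → refl
      (inj₁ (refl , _))    (inj₂ b)             → contradiction b opens
      (inj₂ a)             (inj₁ (refl , _))    → contradiction a opens
      (inj₂ a)             (inj₂ b)             → uniqueʳ a b
  ; unchained = λ where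
      (inj₁ (_ , refl))    (inj₁ (refl , _))    → ℕₚ.<-irrefl refl i<
      (inj₁ (_ , refl))    (inj₂ b)             → ℕₚ.<-asym (ordered b) (linked-bound c b)
      (inj₂ a)             (inj₁ (refl , _))    → closes a
      (inj₂ a)             (inj₂ b)             → unchained a b
  ; uncrossed = λ where
      (inj₁ (_ , refl))    (inj₁ (_ , refl)) _ _ n<n _     → ℕₚ.<-irrefl refl n<n
      (inj₁ (_ , refl))    (inj₂ b) _ _ n<j _              → ℕₚ.<-asym n<j (linked-bound c b)
      (inj₂ a)             (inj₁ (refl , refl)) a<i i<j j<n n≤2+j → cross a a<i i<j j<n n≤2+j
      (inj₂ a)             (inj₂ b)             → uncrossed a b
  ; unnested = λ where
      (inj₁ (refl , _))    (inj₁ (refl , _)) i<i _ _       → ℕₚ.<-irrefl refl i<i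
      (inj₁ (_ , refl))    (inj₂ b) _ _ eq                 → no-adjacent-closer c i∈ b (≡.sym eq)
      (inj₂ a)             (inj₁ (_ , refl)) _ _ refl      → ℕₚ.<-asym (linked-bound c a) ℕₚ.≤-refl
      (inj₂ a)             (inj₂ b)             → unnested a b
  }
  where
  open Admissible adm
  i∈u = options⊆unpicked c i∈
  i<  = All.lookup (unpicked-bounded c) i∈u
  closes : ∀ {h} → ¬ Linked c h i
  closes = proj₁ (unpicked-sound c i∈u)
  opens : ∀ {j} → ¬ Linked c i j
  opens = proj₂ (unpicked-sound c i∈u) ordered

  cross : ∀ {a j} → Linked c a j → a < i → i < j → j < length c → ¬ length c ≤ 2 ℕ.+ j
  -- The new closer stands one or two positions after `j`.
  cross {j = j} b a<i i<j j<n n≤2+j with suc j ℕₚ.≟ length c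
  ... | yes eq = no-adjacent-closer c i∈ b eq
  ... | no neq = no-crossing-pick c i∈ b (ℕₚ.≤-antisym (ℕₚ.≤∧≢⇒< j<n neq) n≤2+j) a<i i<j

valid⇒admissible : ∀ c → Valid c → Admissible (Linked c)
valid⇒admissible [] _ = record
  { ordered   = λ ()
  ; uniqueˡ   = λ ()
  ; uniqueʳ   = λ ()
  ; unchained = λ ()
  ; uncrossed = λ ()
  ; unnested  = λ ()
  }
valid⇒admissible (nothing ∷ c) v        = admissible-antitone (λ { (inj₂ a) → a }) (valid⇒admissible c v)
valid⇒admissible (just i  ∷ c) (i∈ , v) = admissible-extend c i (valid⇒admissible c v) i∈

admissible⇒option : ∀ c {i} → Admissible (Linked (just i ∷ c)) → i ∈ options c
admissible⇒option []            adm = ⊥-elim (ℕₚ.n≮0 (Admissible.ordered adm (inj₁ (refl , refl))))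
admissible⇒option (just a ∷ c) {i} adm = ⊥-elim (conflict (ℕₚ.<-cmp a i))
  where
  open Admissible adm
  new = inj₁ (refl , refl)
  old = inj₂ (inj₁ (refl , refl))
  -- Position `length c` closes an arc, so it cannot be the opener of the new one.
  i<n : i < length c
  i<n = ℕₚ.≤∧≢⇒< (ℕₚ.≤-pred (ordered new)) λ { refl → unchained old new }
  conflict : _ → ⊥
  conflict (tri< a<i _ _)    = uncrossed old new a<i i<n ℕₚ.≤-refl (ℕₚ.n≤1+n _)
  conflict (tri≈ _ refl _)   = ℕₚ.1+n≢n (uniqueʳ new old)
  conflict (tri> _ _ i<a)    = unnested new old i<a (ordered old) refl
admissible⇒option (nothing ∷ c) {i} adm with unpicked-complete (nothing ∷ c)
  (ordered new) (λ a → unchained (inj₂ a) new) (λ a → ℕₚ.<-irrefl (uniqueʳ (inj₂ a) new) (linked-bound (nothing ∷ c) a))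
  where
  open Admissible adm
  new = inj₁ (refl , refl)
... | here eq   = here eq
... | there i∈c = there (allow c adm i∈c)
  where
  allow : ∀ c → Admissible (Linked (just i ∷ nothing ∷ c)) → i ∈ unpicked c → i ∈ permitted c
  allow (nothing ∷ c)  adm i∈c = i∈c
  allow (just a  ∷ c)  adm i∈c = ∈ₚ.∈-filter⁺ (ℕₚ._<? a) i∈c (i<a (ℕₚ.<-cmp i a))
    where
    open Admissible adm
    new = inj₁ (refl , refl)
    -- This closer stands two positions before the new one, so an opener above `a` would make a
    -- forbidden crossing.
    old = inj₂ (inj₂ (inj₁ (refl , refl)))
    i<n : i < length c
    i<n = ℕₚ.≤∧≢⇒< (ℕₚ.≤-pred (All.lookup (unpicked-bounded (just a ∷ c)) i∈c)) λ { refl → unchained old new }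
    i<a : _ → i < a
    i<a (tri< lt _ _)   = lt
    i<a (tri≈ _ refl _) = ⊥-elim (ℕₚ.<⇒≢ (ℕₚ.m<n⇒m<1+n ℕₚ.≤-refl) (uniqueʳ old new))
    i<a (tri> _ _ a<i)  = ⊥-elim (uncrossed old new a<i i<n (ℕₚ.m<n⇒m<1+n ℕₚ.≤-refl) ℕₚ.≤-refl)

admissible⇒valid : ∀ c → Admissible (Linked c) → Valid c
admissible⇒valid []            adm = tt
admissible⇒valid (nothing ∷ c) adm = admissible⇒valid c (admissible-antitone inj₂ adm)
admissible⇒valid (just i  ∷ c) adm = admissible⇒option c adm , admissible⇒valid c (admissible-antitone inj₂ adm)

-- The arc ending at the last position determines the last letter. Equal lengths are assumed because
-- `nothing` leaves no trace among the arcs.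
linked-injective : ∀ c c′ → length c ≡ length c′ →
  (∀ {i j} → Linked c i j → Linked c′ i j) → (∀ {i j} → Linked c′ i j → Linked c i j) → c ≡ c′
linked-injective []      []        _  _ _ = refl
linked-injective (l ∷ c) (l′ ∷ c′) eq f g =
  ≡.cong₂ _∷_ (same l l′ f g) (linked-injective c c′ len (restrict c c′ len f) (restrict c′ c (≡.sym len) g))
  where
  len : length c ≡ length c′
  len = ℕₚ.suc-injective eq

  restrict : ∀ {l l′} c c′ → length c ≡ length c′ →
    (∀ {i j} → Linked (l ∷ c) i j → Linked (l′ ∷ c′) i j) → ∀ {i j} → Linked c i j → Linked c′ i j
  restrict c c′ len f a with f (inj₂ a)
  ... | inj₁ (_ , refl) = contradiction (≡.subst (_ <_) len (linked-bound c a)) (ℕₚ.<-irrefl refl)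
  ... | inj₂ b          = b

  same : ∀ l l′ → (∀ {i j} → Linked (l ∷ c) i j → Linked (l′ ∷ c′) i j) →
    (∀ {i j} → Linked (l′ ∷ c′) i j → Linked (l ∷ c) i j) → l ≡ l′
  same nothing  nothing  _ _ = refl
  same (just i) l′       f _ = ≡.sym (linked-last {c = c′} (f (inj₁ (refl , ≡.sym len))))
  same nothing  (just i) _ g = linked-last {c = c} (g (inj₁ (refl , len)))

-- The enumeration is complete and free of repetitions

openers closers : Code → ℕ
openers []            = 0
openers (nothing ∷ c) = suc (openers c)
openers (just _  ∷ c) = openers c
closers []            = 0
closers (nothing ∷ c) = closers c
closers (just _  ∷ c) = suc (closers c)

openers+closers : ∀ c → openers c ℕ.+ closers c ≡ length c
openers+closers []            = refl
openers+closers (nothing ∷ c) = ≡.cong suc (openers+closers c)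
openers+closers (just _  ∷ c) = ≡.trans (ℕₚ.+-suc (openers c) (closers c)) (≡.cong suc (openers+closers c))

pick⁺ : ∀ {c c′ a b i} → i ∈ options c → c′ ∈ extensions a b (just i ∷ c) →
  c′ ∈ concatMap (λ i → extensions a b (just i ∷ c)) (options c)
pick⁺ i∈ c′∈ = ∈ₚ.∈-concatMap⁺ _ (lose i∈ c′∈)

pick⁻ : ∀ {c c′ a b} → c′ ∈ concatMap (λ i → extensions a b (just i ∷ c)) (options c) →
  ∃[ i ] i ∈ options c × c′ ∈ extensions a b (just i ∷ c)
pick⁻ {c} {a = a} {b} c′∈ = find (∈ₚ.∈-concatMap⁻ (λ i → extensions a b (just i ∷ c)) c′∈)

-- A derivation branches on the next letter alone, while `extensions` also branches on which
-- counters are zero; inductions over derivations avoid these extra cases.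
data Extension (c′ : Code) : ℕ → ℕ → Code → Set where
  done   : Extension c′ 0 0 c′
  opener : ∀ {a b c} → Extension c′ a b (nothing ∷ c) → Extension c′ (suc a) b c
  closer : ∀ {a b c i} → i ∈ options c → Extension c′ a b (just i ∷ c) → Extension c′ a (suc b) c

extension⁻ : ∀ a b c {c′} → c′ ∈ extensions a b c → Extension c′ a b c
extension⁻ zero    zero    c (here refl) = done
extension⁻ (suc a) zero    c c′∈ = opener (extension⁻ a zero (nothing ∷ c) c′∈)
extension⁻ zero    (suc b) c c′∈ =
  let i , i∈ , c′∈′ = pick⁻ {c} {a = 0} {b} c′∈ in
  closer i∈ (extension⁻ zero b (just i ∷ c) c′∈′)
extension⁻ (suc a) (suc b) c c′∈ = Sum.[
    (λ c′∈′ → opener (extension⁻ a (suc b) (nothing ∷ c) c′∈′)) ,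
    (λ c′∈′ → let i , i∈ , c′∈″ = pick⁻ {c} {a = suc a} {b} c′∈′ in
      closer i∈ (extension⁻ (suc a) b (just i ∷ c) c′∈″))
  ] (∈ₚ.∈-++⁻ (extensions a (suc b) (nothing ∷ c)) c′∈)

extension⁺ : ∀ {a b c c′} → Extension c′ a b c → c′ ∈ extensions a b c
extension⁺ done = here refl
extension⁺ {suc a} {zero}  {c} (opener e)    = extension⁺ e
extension⁺ {suc a} {suc b} {c} (opener e)    = ∈ₚ.∈-++⁺ˡ (extension⁺ e)
extension⁺ {zero}  {suc b} {c} (closer i∈ e) = pick⁺ {c} {a = 0} {b} i∈ (extension⁺ e)
extension⁺ {suc a} {suc b} {c} (closer i∈ e) =
  ∈ₚ.∈-++⁺ʳ (extensions a (suc b) (nothing ∷ c)) (pick⁺ {c} {a = suc a} {b} i∈ (extension⁺ e))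

-- The constructors of `Extension` put the earliest letter outermost, but a code exposes its latest
-- letter; the induction on codes therefore needs to append at the far end.
extend-opener : ∀ {a b c c′} → Extension c′ a b c → Extension (nothing ∷ c′) (suc a) b c
extend-opener done          = opener done
extend-opener (opener e)    = opener (extend-opener e)
extend-opener (closer i∈ e) = closer i∈ (extend-opener e)

extend-closer : ∀ {a b c c′ i} → i ∈ options c′ → Extension c′ a b c → Extension (just i ∷ c′) a (suc b) c
extend-closer i∈ done           = closer i∈ done
extend-closer i∈ (opener e)     = opener (extend-closer i∈ e)
extend-closer i∈ (closer i∈′ e) = closer i∈′ (extend-closer i∈ e)

extension-sound : ∀ {a b c c′} → Extension c′ a b c → Valid c →
  Valid c′ × openers c′ ≡ a ℕ.+ openers c × closers c′ ≡ b ℕ.+ closers c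
extension-sound done v = v , refl , refl
extension-sound {suc a} (opener {c = c} e) v with extension-sound e v
... | v′ , o , cl = v′ , ≡.trans o (ℕₚ.+-suc a (openers c)) , cl
extension-sound {b = suc b} (closer {c = c} i∈ e) v with extension-sound e (i∈ , v)
... | v′ , o , cl = v′ , o , ≡.trans cl (ℕₚ.+-suc b (closers c))

extension-complete : ∀ c → Valid c → Extension c (openers c) (closers c) []
extension-complete []            _        = done
extension-complete (nothing ∷ c) v        = extend-opener (extension-complete c v)
extension-complete (just i  ∷ c) (i∈ , v) = extend-closer i∈ (extension-complete c v)

extension-linked : ∀ {a b c c′ i j} → Extension c′ a b c → Linked c i j → Linked c′ i j
extension-linked done         l = l
extension-linked (opener e)   l = extension-linked e (inj₂ l)
extension-linked (closer _ e) l = extension-linked e (inj₂ l)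

-- Later letters only add arcs that close at later positions.
extension-linked⁻ : ∀ {a b c c′ i j} → Extension c′ a b c → j < length c → Linked c′ i j → Linked c i j
extension-linked⁻ done                 j< l = l
extension-linked⁻ (opener e)           j< l with extension-linked⁻ e (ℕₚ.m<n⇒m<1+n j<) l
... | inj₂ l′ = l′
extension-linked⁻ (closer _ e)         j< l with extension-linked⁻ e (ℕₚ.m<n⇒m<1+n j<) l
... | inj₁ (_ , refl) = contradiction j< (ℕₚ.<-irrefl refl)
... | inj₂ l′         = l′

-- The final code still shows the letter at position `length c`, so different choices there never
-- lead to the same result and the branches of `extensions` are disjoint.
extension-letter : ∀ {a b a′ b′ c c′ l i} → Extension c′ a b (l ∷ c) → Extension c′ a′ b′ (just i ∷ c) → l ≡ just i
extension-letter {c = c} e e′ =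
  linked-last {c = c} (extension-linked⁻ e ℕₚ.≤-refl (extension-linked e′ (inj₁ (refl , refl))))

picks-unique : ∀ a b c → (∀ i → Unique (extensions a b (just i ∷ c))) →
  Unique (concatMap (λ i → extensions a b (just i ∷ c)) (options c))
picks-unique a b c unique = Uniqueₚ.concat⁺
  (Allₚ.map⁺ (All.universal unique (options c)))
  (AllPairsₚ.map⁺ (AllPairs.map (λ {i} {i′} i≢i′ {c′} (p , q) →
    i≢i′ (just-injective (extension-letter (extension⁻ a b (just i ∷ c) p) (extension⁻ a b (just i′ ∷ c) q))))
    (options-unique c)))

extensions-unique : ∀ a b c → Unique (extensions a b c)
extensions-unique zero    zero    c = [] ∷ []
extensions-unique (suc a) zero    c = extensions-unique a zero (nothing ∷ c)
extensions-unique zero    (suc b) c = picks-unique 0 b c λ i → extensions-unique 0 b (just i ∷ c)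
extensions-unique (suc a) (suc b) c = Uniqueₚ.++⁺
  (extensions-unique a (suc b) (nothing ∷ c))
  (picks-unique (suc a) b c λ i → extensions-unique (suc a) b (just i ∷ c))
  λ (p , q) → let i , _ , q′ = pick⁻ {c} {a = suc a} {b} q in
    contradiction (extension-letter (extension⁻ a (suc b) (nothing ∷ c) p) (extension⁻ (suc a) b (just i ∷ c) q′)) λ ()

∈-extensions⁻ : ∀ a b {c} → c ∈ extensions a b [] → Valid c × openers c ≡ a × closers c ≡ b
∈-extensions⁻ a b c∈ with extension-sound (extension⁻ a b [] c∈) tt
... | v , o , cl = v , ≡.trans o (ℕₚ.+-identityʳ a) , ≡.trans cl (ℕₚ.+-identityʳ b)

∈-extensions⁺ : ∀ c → Valid c → c ∈ extensions (openers c) (closers c) []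
∈-extensions⁺ c v = extension⁺ (extension-complete c v)

-- Comparing lengths, and lists of sublists

variable
  m : ℕ

∈-remove : ∀ {A : Set} {ys : List A} {y z} (y∈ : y ∈ ys) → z ∈ ys → z ≡ y ⊎ z ∈ (ys ─ y∈)
∈-remove (here refl) (here refl) = inj₁ refl
∈-remove (here refl) (there z∈)  = inj₂ z∈
∈-remove (there y∈)  (here refl) = inj₂ (here refl)
∈-remove (there y∈)  (there z∈)  = Sum.map₂ there (∈-remove y∈ z∈)

-- Each entry of `xs` takes a partner out of `ys`; by injectivity no later entry needs a partner
-- that is already gone. A relation suffices, so no function has to be chosen.
unique-length-≤ : ∀ {A B : Set} (R : A → B → Set) {xs : List A} {ys : List B} → Unique xs →
  (∀ {x} → x ∈ xs → ∃[ y ] y ∈ ys × R x y) →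
  (∀ {x x′ y} → x ∈ xs → x′ ∈ xs → R x y → R x′ y → x ≡ x′) →
  length xs ≤ length ys
unique-length-≤ R {[]}          _             total inj = z≤n
unique-length-≤ R {x ∷ xs} {ys} (x∉ ∷ unique) total inj with total (here refl)
... | y , y∈ , r = ≡.subst (suc (length xs) ≤_) (≡.sym (Listₚ.length-removeAt′ ys (index y∈)))
  (s≤s (unique-length-≤ R unique total′ λ p q → inj (there p) (there q)))
  where
  total′ : ∀ {x′} → x′ ∈ xs → ∃[ z ] z ∈ (ys ─ y∈) × R x′ z
  total′ x′∈ with total (there x′∈)
  ... | z , z∈ , r′ with ∈-remove y∈ z∈
  ...   | inj₁ refl = contradiction (inj (here refl) (there x′∈) r r′) (All.lookup x∉ x′∈)
  ...   | inj₂ z∈′  = z , z∈′ , r′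

allPairs-distinct : ∀ {A : Set} {Q : A → Set} {S : A → A → Set} →
  (∀ {x y} → Q x → Q y → x ≢ y → S x y) → ∀ {xs} → Unique xs → All Q xs → AllPairs S xs
allPairs-distinct f []             []        = []
allPairs-distinct f (x∉ ∷ unique)  (qx ∷ qs) =
  All.zipWith (λ (x≢y , qy) → f qx qy x≢y) (x∉ , qs) ∷ allPairs-distinct f unique qs

sublist-⊆ : ∀ {A : Set} as {bs : List A} {b} → bs ∈ sublists as → b ∈ bs → b ∈ as
sublist-⊆ [] (here refl) b∈ = b∈
sublist-⊆ (a ∷ as) bs∈ b∈ with ∈ₚ.∈-++⁻ (map (a ∷_) (sublists as)) bs∈
... | inj₂ bs∈′ = there (sublist-⊆ as bs∈′ b∈)
... | inj₁ bs∈′ with ∈ₚ.∈-map⁻ (a ∷_) bs∈′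
sublist-⊆ (a ∷ as) bs∈ (here refl) | inj₁ _ | _ , _ , refl = here refl
sublist-⊆ (a ∷ as) bs∈ (there b∈)  | inj₁ _ | _ , bs∈″ , refl = there (sublist-⊆ as bs∈″ b∈)

sublists-unique : ∀ {A : Set} {as : List A} → Unique as → Unique (sublists as)
sublists-unique {as = []}     _              = [] ∷ []
sublists-unique {as = a ∷ as} (a∉ ∷ unique) = Uniqueₚ.++⁺
  (Uniqueₚ.map⁺ Listₚ.∷-injectiveʳ (sublists-unique unique)) (sublists-unique unique) disjoint
  where
  disjoint : ∀ {bs} → ¬ (bs ∈ map (a ∷_) (sublists as) × bs ∈ sublists as)
  disjoint (p , q) with ∈ₚ.∈-map⁻ (a ∷_) p
  ... | _ , _ , refl = All.lookup a∉ (sublist-⊆ as q (here refl)) refl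

sublist-unique : ∀ {A : Set} {as bs : List A} → Unique as → bs ∈ sublists as → Unique bs
sublist-unique {as = []}     _             (here refl) = []
sublist-unique {as = a ∷ as} (a∉ ∷ unique) bs∈ with ∈ₚ.∈-++⁻ (map (a ∷_) (sublists as)) bs∈
... | inj₂ bs∈′ = sublist-unique unique bs∈′
... | inj₁ bs∈′ with ∈ₚ.∈-map⁻ (a ∷_) bs∈′
...   | cs , cs∈ , refl = All.tabulate (λ c∈ → All.lookup a∉ (sublist-⊆ as cs∈ c∈)) ∷ sublist-unique unique cs∈

filter∈sublists : ∀ {A : Set} {Q : A → Set} (Q? : Decidable Q) as → filter Q? as ∈ sublists as
filter∈sublists Q? []       = here refl
filter∈sublists Q? (a ∷ as) with Q? a
... | yes _ = ∈ₚ.∈-++⁺ˡ (∈ₚ.∈-map⁺ (a ∷_) (filter∈sublists Q? as))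
... | no  _ = ∈ₚ.∈-++⁺ʳ (map (a ∷_) (sublists as)) (filter∈sublists Q? as)

-- A sublist inherits the order of a duplicate-free list, so its members determine it.
sublists-ext : ∀ {A : Set} {as bs cs : List A} → Unique as → bs ∈ sublists as → cs ∈ sublists as →
  (∀ {a} → a ∈ bs → a ∈ cs) → (∀ {a} → a ∈ cs → a ∈ bs) → bs ≡ cs
sublists-ext {as = []} _ (here refl) (here refl) _ _ = refl
sublists-ext {as = a ∷ as} (a∉ ∷ unique) bs∈ cs∈ f g
  with ∈ₚ.∈-++⁻ (map (a ∷_) (sublists as)) bs∈ | ∈ₚ.∈-++⁻ (map (a ∷_) (sublists as)) cs∈
... | inj₂ p | inj₂ q = sublists-ext unique p q f g
... | inj₁ p | inj₂ q with ∈ₚ.∈-map⁻ (a ∷_) p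
...   | _ , _ , refl = contradiction refl (All.lookup a∉ (sublist-⊆ as q (f (here refl))))
sublists-ext {as = a ∷ as} (a∉ ∷ unique) bs∈ cs∈ f g | inj₂ p | inj₁ q with ∈ₚ.∈-map⁻ (a ∷_) q
...   | _ , _ , refl = contradiction refl (All.lookup a∉ (sublist-⊆ as p (g (here refl))))
sublists-ext {as = a ∷ as} (a∉ ∷ unique) bs∈ cs∈ f g | inj₁ p | inj₁ q
  with ∈ₚ.∈-map⁻ (a ∷_) p | ∈ₚ.∈-map⁻ (a ∷_) q
...   | bs , bs∈′ , refl | cs , cs∈′ , refl =
  ≡.cong (a ∷_) (sublists-ext unique bs∈′ cs∈′ (drop bs∈′ f) (drop cs∈′ g))
  where
  drop : ∀ {ds es} → ds ∈ sublists as → (∀ {b} → b ∈ a ∷ ds → b ∈ a ∷ es) → ∀ {b} → b ∈ ds → b ∈ es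
  drop ds∈ h b∈ with h (there b∈)
  ... | here refl = contradiction refl (All.lookup a∉ (sublist-⊆ as ds∈ b∈))
  ... | there b∈′ = b∈′

∈-subsets : ∀ (B : Subset m) → B ∈ subsets m
∈-subsets []                    = here refl
∈-subsets (inside  ∷ B)         = ∈ₚ.∈-++⁺ˡ (∈ₚ.∈-map⁺ (inside ∷_) (∈-subsets B))
∈-subsets (outside ∷ B)         = ∈ₚ.∈-++⁺ʳ (map (inside ∷_) (subsets _)) (∈ₚ.∈-map⁺ (outside ∷_) (∈-subsets B))

subsets-unique : ∀ m → Unique (subsets m)
subsets-unique zero    = [] ∷ []
subsets-unique (suc m) = Uniqueₚ.++⁺
  (Uniqueₚ.map⁺ Vecₚ.∷-injectiveʳ (subsets-unique m))
  (Uniqueₚ.map⁺ Vecₚ.∷-injectiveʳ (subsets-unique m))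
  disjoint
  where
  disjoint : ∀ {B} → ¬ (B ∈ map (inside ∷_) (subsets m) × B ∈ map (outside ∷_) (subsets m))
  disjoint (p , q) with ∈ₚ.∈-map⁻ (inside ∷_) p | ∈ₚ.∈-map⁻ (outside ∷_) q
  ... | _ , _ , refl | _ , _ , ()

-- Blocks with at most two elements

size≤0 : ∀ (B : Subset m) → ∣ B ∣ ≤ 0 → B ≡ ⊥ˢ
size≤0 []            _ = refl
size≤0 (outside ∷ B) p = ≡.cong (outside ∷_) (size≤0 B p)

size≤1 : ∀ (B : Subset m) → ∣ B ∣ ≤ 1 → B ≡ ⊥ˢ ⊎ (∃[ i ] B ≡ ⁅ i ⁆)
size≤1 []            _       = inj₁ refl
size≤1 (inside  ∷ B) (s≤s p) = inj₂ (zero , ≡.cong (inside ∷_) (size≤0 B p))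
size≤1 (outside ∷ B) p       = Sum.map (≡.cong (outside ∷_)) (λ (i , eq) → suc i , ≡.cong (outside ∷_) eq) (size≤1 B p)

data Small {m} : Subset m → Set where
  empty     : Small ⊥ˢ
  singleton : ∀ i → Small ⁅ i ⁆
  pair      : ∀ {i j} → i <ᶠ j → Small (⁅ i ⁆ ∪ ⁅ j ⁆)

small : ∀ (B : Subset m) → ∣ B ∣ ≤ 2 → Small B
small [] _ = empty
small (inside ∷ B) (s≤s p) with size≤1 B p
... | inj₁ refl       = singleton zero
... | inj₂ (i , refl) = ≡.subst (Small ∘ (inside ∷_)) (Subsetₚ.∪-identityˡ ⁅ i ⁆) (pair {i = zero} {suc i} (s≤s z≤n))
small (outside ∷ B) p with small B p
... | empty       = empty
... | singleton i = singleton (suc i)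
... | pair i<j    = pair (s≤s i<j)

size-pair : ∀ {i j : Fin m} → i <ᶠ j → ∣ ⁅ i ⁆ ∪ ⁅ j ⁆ ∣ ≡ 2
size-pair {i = zero}  {suc j} _         =
  ≡.cong suc (≡.trans (≡.cong ∣_∣ (Subsetₚ.∪-identityˡ ⁅ j ⁆)) (Subsetₚ.∣⁅x⁆∣≡1 j))
size-pair {i = suc i} {suc j} (s≤s i<j) = size-pair i<j

∈-pair⁻ : ∀ {i j k : Fin m} → k ∈ˢ ⁅ i ⁆ ∪ ⁅ j ⁆ → k ≡ i ⊎ k ≡ j
∈-pair⁻ {i = i} {j} k∈ = Sum.map (Subsetₚ.x∈⁅y⁆⇒x≡y i) (Subsetₚ.x∈⁅y⁆⇒x≡y j) (Subsetₚ.x∈p∪q⁻ ⁅ i ⁆ ⁅ j ⁆ k∈)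

∈-pairˡ : ∀ (i j : Fin m) → i ∈ˢ ⁅ i ⁆ ∪ ⁅ j ⁆
∈-pairˡ i j = Subsetₚ.x∈p∪q⁺ (inj₁ (Subsetₚ.x∈⁅x⁆ i))

∈-pairʳ : ∀ (i j : Fin m) → j ∈ˢ ⁅ i ⁆ ∪ ⁅ j ⁆
∈-pairʳ i j = Subsetₚ.x∈p∪q⁺ (inj₂ (Subsetₚ.x∈⁅x⁆ j))

pair-injective : ∀ {i j i′ j′ : Fin m} → i <ᶠ j → i′ <ᶠ j′ →
  ⁅ i ⁆ ∪ ⁅ j ⁆ ≡ ⁅ i′ ⁆ ∪ ⁅ j′ ⁆ → i ≡ i′ × j ≡ j′
pair-injective {i = i} {j} {i′} {j′} i<j i′<j′ eq
  with ∈-pair⁻ (≡.subst (i ∈ˢ_) eq (∈-pairˡ i j)) | ∈-pair⁻ (≡.subst (j ∈ˢ_) eq (∈-pairʳ i j))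
... | inj₁ refl | inj₁ refl = contradiction i<j (ℕₚ.<-irrefl refl)
... | inj₁ refl | inj₂ refl = refl , refl
... | inj₂ refl | inj₁ refl = contradiction i<j (ℕₚ.<-asym i′<j′)
... | inj₂ refl | inj₂ refl = contradiction i<j (ℕₚ.<-irrefl refl)

singleton≢pair : ∀ {i j k : Fin m} → i <ᶠ j → ⁅ k ⁆ ≢ ⁅ i ⁆ ∪ ⁅ j ⁆
singleton≢pair {i = i} {j} {k} i<j eq = ℕₚ.<⇒≢ i<j (≡.cong toℕ (≡.trans
  (Subsetₚ.x∈⁅y⁆⇒x≡y k (≡.subst (i ∈ˢ_) (≡.sym eq) (∈-pairˡ i j)))
  (≡.sym (Subsetₚ.x∈⁅y⁆⇒x≡y k (≡.subst (j ∈ˢ_) (≡.sym eq) (∈-pairʳ i j))))))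

disjoint-blocks : ∀ {π : Family m} → AllPairs (λ A B → Empty (A ∩ B)) π →
  ∀ {A B i} → A ∈ π → B ∈ π → i ∈ˢ A → i ∈ˢ B → A ≡ B
disjoint-blocks (_ ∷ _)  (here refl) (here refl) _  _  = refl
disjoint-blocks (p ∷ _)  (here refl) (there B∈)  i∈ i∈′ =
  ⊥-elim (All.lookup p B∈ (_ , Subsetₚ.x∈p∩q⁺ (i∈ , i∈′)))
disjoint-blocks (p ∷ _)  (there A∈)  (here refl) i∈ i∈′ =
  ⊥-elim (All.lookup p A∈ (_ , Subsetₚ.x∈p∩q⁺ (i∈′ , i∈)))
disjoint-blocks (_ ∷ ps) (there A∈)  (there B∈)  i∈ i∈′ = disjoint-blocks ps A∈ B∈ i∈ i∈′

∈-⋃⁻ : ∀ (π : Family m) {i} → i ∈ˢ ⋃ π → ∃[ B ] B ∈ π × i ∈ˢ B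
∈-⋃⁻ []      i∈ = ⊥-elim (Subsetₚ.∉⊥ i∈)
∈-⋃⁻ (B ∷ π) i∈ with Subsetₚ.x∈p∪q⁻ B (⋃ π) i∈
... | inj₁ i∈B = B , here refl , i∈B
... | inj₂ i∈⋃ with ∈-⋃⁻ π i∈⋃
...   | A , A∈ , i∈A = A , there A∈ , i∈A

∈-⋃⁺ : ∀ {π : Family m} {B i} → B ∈ π → i ∈ˢ B → i ∈ˢ ⋃ π
∈-⋃⁺ (here refl) i∈ = Subsetₚ.x∈p∪q⁺ (inj₁ i∈)
∈-⋃⁺ (there B∈)  i∈ = Subsetₚ.x∈p∪q⁺ (inj₂ (∈-⋃⁺ B∈ i∈))

-- These are the blocks that a matching with arc relation `A` must have: the arcs, and a singleton
-- for each point on no arc. Hence arcs alone determine a matching.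
data Block {m} (A : Fin m → Fin m → Set) : Subset m → Set where
  single : ∀ i → (∀ j → ¬ A i j) → (∀ j → ¬ A j i) → Block A ⁅ i ⁆
  arc    : ∀ {i j} → i <ᶠ j → A i j → Block A (⁅ i ⁆ ∪ ⁅ j ⁆)

block? : ∀ {A : Fin m → Fin m → Set} → Decidable₂ A → Decidable (Block A)
block? {A = A} A? B = map′ to from
  (any? (λ i → B ≟ˢ ⁅ i ⁆ ×-dec all? (λ j → ¬? (A? i j)) ×-dec all? (λ j → ¬? (A? j i)))
    ⊎-dec any? (λ i → any? λ j → B ≟ˢ (⁅ i ⁆ ∪ ⁅ j ⁆) ×-dec i <ᶠ? j ×-dec A? i j))
  where
  to : _ → Block A B
  to (inj₁ (i , refl , p , q))       = single i p q
  to (inj₂ (i , j , refl , i<j , a)) = arc i<j a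
  from : Block A B → _
  from (single i p q) = inj₁ (i , refl , p , q)
  from (arc i<j a)    = inj₂ (_ , _ , refl , i<j , a)

block-arc : ∀ {A : Fin m → Fin m → Set} {B i j} → Block A B → i <ᶠ j → B ≡ ⁅ i ⁆ ∪ ⁅ j ⁆ → A i j
block-arc (single k _ _) i<j eq = contradiction eq (singleton≢pair i<j)
block-arc (arc i′<j′ a)  i<j eq with pair-injective i′<j′ i<j eq
... | refl , refl = a

module _ {π : Family m} (matching : IsPartialMatching π) where
  private
    nonempty = proj₁ (proj₁ matching)
    disjoint = proj₁ (proj₂ (proj₁ matching))
    covering = proj₂ (proj₂ (proj₁ matching))
    sizes    = proj₂ matching

  arcs-share : ∀ {i j i′ j′ k} → Arc π i j → Arc π i′ j′ → k ∈ˢ ⁅ i ⁆ ∪ ⁅ j ⁆ → k ∈ˢ ⁅ i′ ⁆ ∪ ⁅ j′ ⁆ → i ≡ i′ × j ≡ j′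
  arcs-share (i<j , A∈) (i′<j′ , B∈) k∈ k∈′ = pair-injective i<j i′<j′ (disjoint-blocks disjoint A∈ B∈ k∈ k∈′)

  block⁺ : ∀ {B} → B ∈ π → Block (Arc π) B
  block⁺ {B} B∈ = classify (small B (All.lookup sizes B∈)) B∈ (All.lookup nonempty B∈)
    where
    classify : ∀ {B} → Small B → B ∈ π → Nonempty B → Block (Arc π) B
    classify empty          _  (_ , i∈) = ⊥-elim (Subsetₚ.∉⊥ i∈)
    classify (singleton i)  B∈ _        = single i
      (λ j (i<j , A∈) → singleton≢pair i<j (disjoint-blocks disjoint B∈ A∈ (Subsetₚ.x∈⁅x⁆ i) (∈-pairˡ i j)))
      (λ j (j<i , A∈) → singleton≢pair j<i (disjoint-blocks disjoint B∈ A∈ (Subsetₚ.x∈⁅x⁆ i) (∈-pairʳ j i)))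
    classify (pair i<j)     B∈ _        = arc i<j (i<j , B∈)

  -- The partition covers a point on no arc by some block, and that block cannot be a pair, since a
  -- pair would be an arc through the point.
  block⁻ : ∀ {B} → Block (Arc π) B → B ∈ π
  block⁻ (arc _ (_ , B∈))            = B∈
  block⁻ (single i unopened unclosed) with ∈-⋃⁻ π (≡.subst (i ∈ˢ_) (≡.sym covering) Subsetₚ.∈⊤)
  ... | B , B∈ , i∈ with small B (All.lookup sizes B∈)
  ...   | empty       = ⊥-elim (Subsetₚ.∉⊥ i∈)
  ...   | singleton k with Subsetₚ.x∈⁅y⁆⇒x≡y k i∈
  ...     | refl = B∈
  block⁻ (single i unopened unclosed) | B , B∈ , i∈ | pair {j} {k} j<k with ∈-pair⁻ i∈
  ...     | inj₁ refl = ⊥-elim (unopened k (j<k , B∈))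
  ...     | inj₂ refl = ⊥-elim (unclosed j (j<k , B∈))

-- The code of a matching

codeOf : ∀ {A : ℕ → ℕ → Set} → Decidable₂ A → ℕ → Code
codeOf A? zero    = []
codeOf A? (suc n) with ℕₚ.anyUpTo? (λ i → A? i n) n
... | yes (i , _) = just i ∷ codeOf A? n
... | no _        = nothing ∷ codeOf A? n

module _ {A : ℕ → ℕ → Set} (A? : Decidable₂ A) where

  length-codeOf : ∀ n → length (codeOf A? n) ≡ n
  length-codeOf zero    = refl
  length-codeOf (suc n) with ℕₚ.anyUpTo? (λ i → A? i n) n
  ... | yes _ = ≡.cong suc (length-codeOf n)
  ... | no _  = ≡.cong suc (length-codeOf n)

  codeOf⁻ : ∀ n {i j} → Linked (codeOf A? n) i j → A i j
  codeOf⁻ (suc n) l with ℕₚ.anyUpTo? (λ i → A? i n) n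
  codeOf⁻ (suc n) (inj₁ (refl , refl)) | yes (i , _ , a) = ≡.subst (A i) (≡.sym (length-codeOf n)) a
  codeOf⁻ (suc n) (inj₂ l)             | yes _           = codeOf⁻ n l
  codeOf⁻ (suc n) (inj₂ l)             | no _            = codeOf⁻ n l

  codeOf⁺ : Admissible A → ∀ n {i j} → j < n → A i j → Linked (codeOf A? n) i j
  codeOf⁺ adm (suc n) {i} {j} j<1+n a with j ℕₚ.≟ n | ℕₚ.anyUpTo? (λ i → A? i n) n
  -- The search may have found another opener than `i`; uniqueness identifies them.
  ... | yes refl | yes (i′ , _ , a′) = inj₁ (≡.cong just (Admissible.uniqueˡ adm a′ a) , ≡.sym (length-codeOf n))
  ... | yes refl | no none           = contradiction (i , Admissible.ordered adm a , a) none
  ... | no j≢n   | yes _             = inj₂ (codeOf⁺ adm n (ℕₚ.≤∧≢⇒< (ℕₚ.≤-pred j<1+n) j≢n) a)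
  ... | no j≢n   | no _              = inj₂ (codeOf⁺ adm n (ℕₚ.≤∧≢⇒< (ℕₚ.≤-pred j<1+n) j≢n) a)

SameArcs : Family m → Code → Set
SameArcs π c = ∀ i j → (Arc π i j → Linked c (toℕ i) (toℕ j)) × (Linked c (toℕ i) (toℕ j) → Arc π i j)

linked-bound′ : ∀ c {i j} → Admissible (Linked c) → Linked c i j → i < length c × j < length c
linked-bound′ c adm l = ℕₚ.<-trans (Admissible.ordered adm l) (linked-bound c l) , linked-bound c l

linked-Fin : ∀ c → length c ≡ m → Admissible (Linked c) → ∀ {i j} → Linked c i j →
  ∃[ p ] ∃[ q ] toℕ {m} p ≡ i × toℕ {m} q ≡ j
linked-Fin c refl adm l =
  fromℕ< i< , fromℕ< j< , Finₚ.toℕ-fromℕ< i< , Finₚ.toℕ-fromℕ< j<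
  where
  i< = proj₁ (linked-bound′ c adm l)
  j< = proj₂ (linked-bound′ c adm l)

closings : Code → List ℕ
closings []            = []
closings (nothing ∷ c) = closings c
closings (just _  ∷ c) = length c ∷ closings c

length-closings : ∀ c → length (closings c) ≡ closers c
length-closings []            = refl
length-closings (nothing ∷ c) = length-closings c
length-closings (just _  ∷ c) = ≡.cong suc (length-closings c)

closings⁻ : ∀ c {j} → j ∈ closings c → ∃[ i ] Linked c i j
closings⁻ (nothing ∷ c) j∈          = let i , l = closings⁻ c j∈ in i , inj₂ l
closings⁻ (just i  ∷ c) (here refl) = i , inj₁ (refl , refl)
closings⁻ (just _  ∷ c) (there j∈)  = let i , l = closings⁻ c j∈ in i , inj₂ l

closings⁺ : ∀ c {i j} → Linked c i j → j ∈ closings c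
closings⁺ (just _  ∷ c) (inj₁ (_ , refl)) = here refl
closings⁺ (nothing ∷ c) (inj₂ l)          = closings⁺ c l
closings⁺ (just _  ∷ c) (inj₂ l)          = there (closings⁺ c l)

closings-unique : ∀ c → Unique (closings c)
closings-unique []            = []
closings-unique (nothing ∷ c) = closings-unique c
closings-unique (just _  ∷ c) =
  All.tabulate (λ j∈ → ℕₚ.>⇒≢ (linked-bound c (proj₂ (closings⁻ c j∈)))) ∷ closings-unique c

-- A block of size two is matched with its larger element.
arcs≡closers : ∀ {π : Family m} c → Unique π → IsPartialMatching π → length c ≡ m → Admissible (Linked c) →
  SameArcs π c → arcs π ≡ closers c
arcs≡closers {m = m} {π} c unique matching len adm same = ≡.trans
  (ℕₚ.≤-antisym
    (unique-length-≤ ClosedBy (Uniqueₚ.filter⁺ size2? unique) closing closedBy-injective)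
    (unique-length-≤ (λ j B → ClosedBy B j) (closings-unique c) closed λ _ _ → closedBy-functional))
  (length-closings c)
  where
  size2? : Decidable (λ (B : Subset m) → ∣ B ∣ ≡ 2)
  size2? B = ∣ B ∣ ℕₚ.≟ 2

  ClosedBy : Subset m → ℕ → Set
  ClosedBy B j = ∃[ p ] ∃[ q ] p <ᶠ q × toℕ {m} q ≡ j × B ≡ ⁅ p ⁆ ∪ ⁅ q ⁆

  closing : ∀ {B} → B ∈ filter size2? π → ∃[ j ] j ∈ closings c × ClosedBy B j
  closing {B} B∈ with ∈ₚ.∈-filter⁻ size2? {xs = π} B∈
  ... | B∈π , size with block⁺ matching B∈π
  ...   | single i _ _ = contradiction (≡.trans (≡.sym (Subsetₚ.∣⁅x⁆∣≡1 i)) size) λ ()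
  ...   | arc {i} {j} i<j a = toℕ j , closings⁺ c (proj₁ (same i j) a) , i , j , i<j , refl , refl

  closedBy-injective : ∀ {B B′ j} → B ∈ filter size2? π → B′ ∈ filter size2? π →
    ClosedBy B j → ClosedBy B′ j → B ≡ B′
  closedBy-injective B∈ B′∈ (p , q , p<q , refl , refl) (p′ , q′ , p′<q′ , eq , refl)
    with Finₚ.toℕ-injective eq
  ... | refl = disjoint-blocks (proj₁ (proj₂ (proj₁ matching)))
    (proj₁ (∈ₚ.∈-filter⁻ size2? {xs = π} B∈)) (proj₁ (∈ₚ.∈-filter⁻ size2? {xs = π} B′∈))
    (∈-pairʳ p q) (∈-pairʳ p′ q)

  closed : ∀ {j} → j ∈ closings c → ∃[ B ] B ∈ filter size2? π × ClosedBy B j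
  closed j∈ with closings⁻ c j∈
  ... | i , l with linked-Fin c len adm l
  ...   | p , q , refl , refl with proj₂ (same p q) l
  ...     | p<q , B∈ = _ , ∈ₚ.∈-filter⁺ size2? B∈ (size-pair p<q) , p , q , p<q , refl , refl

  closedBy-functional : ∀ {j j′ B} → ClosedBy B j → ClosedBy B j′ → j ≡ j′
  closedBy-functional (p , q , p<q , refl , refl) (p′ , q′ , p′<q′ , refl , eq) =
    ≡.cong toℕ (proj₂ (pair-injective p<q p′<q′ eq))

-- Arcs are carried from `Fin m` to ℕ, where `Admissible` and `codeOf` live.
ArcAt : Family m → ℕ → ℕ → Set
ArcAt π i j = ∃[ p ] ∃[ q ] Arc π p q × toℕ p ≡ i × toℕ q ≡ j

arcAt? : ∀ (π : Family m) → Decidable₂ (ArcAt π)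
arcAt? π i j = any? λ p → any? λ q → arc? π p q ×-dec toℕ p ℕₚ.≟ i ×-dec toℕ q ℕₚ.≟ j

arcAt-admissible : ∀ {π : Family m} → IsPartialMatching π → ¬ TwoRightCrossing π → ¬ RightNesting π → Admissible (ArcAt π)
arcAt-admissible {π = π} matching uncrossed unnested = record
  { ordered   = λ { (p , q , (p<q , _) , refl , refl) → p<q }
  ; uniqueˡ   = λ { (p , q , a , refl , refl) (p′ , q′ , a′ , refl , eq) →
      ≡.cong toℕ (proj₁ (arcs-share matching a a′ (∈-pairʳ p q)
        (≡.subst (_∈ˢ ⁅ p′ ⁆ ∪ ⁅ q′ ⁆) (Finₚ.toℕ-injective eq) (∈-pairʳ p′ q′)))) }
  ; uniqueʳ   = λ { (p , q , a , refl , refl) (p′ , q′ , a′ , eq , refl) →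
      ≡.cong toℕ (proj₂ (arcs-share matching a a′ (∈-pairˡ p q)
        (≡.subst (_∈ˢ ⁅ p′ ⁆ ∪ ⁅ q′ ⁆) (Finₚ.toℕ-injective eq) (∈-pairˡ p′ q′)))) }
  ; unchained = λ { (p , q , a , refl , refl) (p′ , q′ , a′ , eq , refl) →
      ℕₚ.<-irrefl (≡.trans (≡.cong toℕ (proj₁ (arcs-share matching a a′ (∈-pairʳ p q)
        (≡.subst (_∈ˢ ⁅ p′ ⁆ ∪ ⁅ q′ ⁆) (Finₚ.toℕ-injective eq) (∈-pairˡ p′ q′))))) eq) (proj₁ a) }
  ; uncrossed = λ { (p , q , a , refl , refl) (p′ , q′ , a′ , refl , refl) p<p′ p′<q q<q′ close →
      uncrossed (p , q , p′ , q′ , a , a′ , p<p′ , p′<q , q<q′ ,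
        ℕₚ.m≤n+o⇒m∸n≤o (toℕ q′) (toℕ q) (≡.subst (toℕ q′ ≤_) (ℕₚ.+-comm 2 (toℕ q)) close)) }
  ; unnested  = λ { (p , q , a , refl , refl) (p′ , q′ , a′ , refl , refl) p<p′ p′<q′ eq →
      unnested (p , q , p′ , q′ , a , a′ , p<p′ , p′<q′ ,
        ≡.subst (toℕ q′ <_) (≡.sym eq) ℕₚ.≤-refl , ≡.trans eq (ℕₚ.+-comm 1 (toℕ q′))) }
  }

codes : ℕ → ℕ → List Code
codes a k = extensions a k []

code-of-counted : ∀ a k {π : Family (a ℕ.+ k)} → π ∈ filter (counted? k) (families (a ℕ.+ k)) →
  ∃[ c ] c ∈ codes a k × SameArcs π c
code-of-counted a k {π} π∈ with ∈ₚ.∈-filter⁻ (counted? k) {xs = families (a ℕ.+ k)} π∈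
... | π∈f , matching , arcs≡k , uncrossed , unnested =
  c , ≡.subst₂ (λ a′ k′ → c ∈ codes a′ k′) openers≡ closers≡ (∈-extensions⁺ c (admissible⇒valid c adm′)) , same
  where
  m′ = a ℕ.+ k
  adm = arcAt-admissible matching uncrossed unnested
  c = codeOf (arcAt? π) m′
  adm′ : Admissible (Linked c)
  adm′ = admissible-antitone (codeOf⁻ (arcAt? π) m′) adm
  same : SameArcs π c
  same i j = (λ a → codeOf⁺ (arcAt? π) adm m′ (Finₚ.toℕ<n j) (i , j , a , refl , refl)) ,
    λ l → back (codeOf⁻ (arcAt? π) m′ l)
    where
    back : ArcAt π (toℕ i) (toℕ j) → Arc π i j
    back (p , q , a , eq , eq′) = ≡.subst₂ (Arc π) (Finₚ.toℕ-injective eq) (Finₚ.toℕ-injective eq′) a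
  closers≡ : closers c ≡ k
  closers≡ = ≡.trans (≡.sym (arcs≡closers c (sublist-unique (subsets-unique m′) π∈f) matching
    (length-codeOf (arcAt? π) m′) adm′ same)) arcs≡k
  -- The length is a + k and the closers number k, one per arc, which leaves a non-closers.
  openers≡ : openers c ≡ a
  openers≡ = ℕₚ.+-cancelʳ-≡ k (openers c) a (≡.trans (≡.cong (openers c ℕ.+_) (≡.sym closers≡))
    (≡.trans (openers+closers c) (length-codeOf (arcAt? π) m′)))

-- The matching of a code, and the comparison of the counts

linked? : ∀ c → Decidable₂ (Linked c)
linked? []      i j = no λ ()
linked? (l ∷ c) i j = (Maybeₚ.≡-dec ℕₚ._≟_ l (just i) ×-dec j ℕₚ.≟ length c) ⊎-dec linked? c i j

module FamilyOf (c : Code) (len : length c ≡ m) (adm : Admissible (Linked c)) where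
  open Admissible adm

  A : Fin m → Fin m → Set
  A i j = Linked c (toℕ i) (toℕ j)

  A? : Decidable₂ A
  A? i j = linked? c (toℕ i) (toℕ j)

  -- Filtering `subsets m` keeps its fixed order, so the result is literally an entry of
  -- `families m`.
  π : Family m
  π = filter (block? A?) (subsets m)

  block∈ : ∀ {B} → Block A B → B ∈ π
  block∈ {B} = ∈ₚ.∈-filter⁺ (block? A?) (∈-subsets B)

  π-unique : Unique π
  π-unique = Uniqueₚ.filter⁺ (block? A?) (subsets-unique m)

  blocks-meet : ∀ {B B′ i} → Block A B → Block A B′ → i ∈ˢ B → i ∈ˢ B′ → B ≡ B′
  blocks-meet (single i _ _) (single i′ _ _) k∈ k∈′
    with Subsetₚ.x∈⁅y⁆⇒x≡y i k∈ | Subsetₚ.x∈⁅y⁆⇒x≡y i′ k∈′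
  ... | refl | refl = refl
  blocks-meet (single i p q) (arc _ a) k∈ k∈′ with Subsetₚ.x∈⁅y⁆⇒x≡y i k∈ | ∈-pair⁻ k∈′
  ... | refl | inj₁ refl = contradiction a (p _)
  ... | refl | inj₂ refl = contradiction a (q _)
  blocks-meet (arc _ a) (single i p q) k∈ k∈′ with ∈-pair⁻ k∈ | Subsetₚ.x∈⁅y⁆⇒x≡y i k∈′
  ... | inj₁ refl | refl = contradiction a (p _)
  ... | inj₂ refl | refl = contradiction a (q _)
  blocks-meet (arc _ a) (arc _ a′) k∈ k∈′ with ∈-pair⁻ k∈ | ∈-pair⁻ k∈′
  ... | inj₁ refl | inj₁ refl = ≡.cong (λ j → ⁅ _ ⁆ ∪ ⁅ j ⁆) (Finₚ.toℕ-injective (uniqueʳ a a′))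
  ... | inj₁ refl | inj₂ refl = contradiction a (unchained a′)
  ... | inj₂ refl | inj₁ refl = contradiction a′ (unchained a)
  ... | inj₂ refl | inj₂ refl = ≡.cong (λ i → ⁅ i ⁆ ∪ ⁅ _ ⁆) (Finₚ.toℕ-injective (uniqueˡ a a′))

  nonempty : ∀ {B} → Block A B → Nonempty B
  nonempty (single i _ _)  = i , Subsetₚ.x∈⁅x⁆ i
  nonempty (arc {i} {j} _ _) = i , ∈-pairˡ i j

  size≤2 : ∀ {B} → Block A B → ∣ B ∣ ≤ 2
  size≤2 (single i _ _) = ℕₚ.≤-trans (ℕₚ.≤-reflexive (Subsetₚ.∣⁅x⁆∣≡1 i)) (s≤s z≤n)
  size≤2 (arc i<j _)    = ℕₚ.≤-reflexive (size-pair i<j)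

  covered : ∀ i → i ∈ˢ ⋃ π
  covered i with any? (λ j → A? i j) | any? (λ j → A? j i)
  ... | yes (j , a) | _           = ∈-⋃⁺ (block∈ (arc (ordered a) a)) (∈-pairˡ i j)
  ... | no _        | yes (j , a) = ∈-⋃⁺ (block∈ (arc (ordered a) a)) (∈-pairʳ j i)
  ... | no p        | no q        =
    ∈-⋃⁺ (block∈ (single i (λ j a → p (j , a)) (λ j a → q (j , a)))) (Subsetₚ.x∈⁅x⁆ i)

  all-blocks : All (Block A) π
  all-blocks = Allₚ.all-filter (block? A?) (subsets m)

  matching : IsPartialMatching π
  matching =
    ( All.map nonempty all-blocks
    , allPairs-distinct (λ b b′ B≢B′ (i , i∈) → let i∈B , i∈B′ = Subsetₚ.x∈p∩q⁻ _ _ i∈ in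
        B≢B′ (blocks-meet b b′ i∈B i∈B′)) π-unique all-blocks
    , Subsetₚ.⊆-antisym Subsetₚ.⊆⊤ (λ {i} _ → covered i)
    ) , All.map size≤2 all-blocks

  same : SameArcs π c
  same i j = (λ (i<j , B∈) → block-arc (All.lookup all-blocks B∈) i<j refl) ,
    λ a → ordered a , block∈ (arc (ordered a) a)

  counted : Counted (closers c) π
  counted = matching , arcs≡closers c π-unique matching len adm same ,
    (λ (i , j , i′ , j′ , a , a′ , i<i′ , i′<j , j<j′ , close) →
      uncrossed (proj₁ (same i j) a) (proj₁ (same i′ j′) a′) i<i′ i′<j j<j′
        (ℕₚ.≤-trans (ℕₚ.m≤n+m∸n (toℕ j′) (toℕ j))
          (≡.subst (_≤ 2 ℕ.+ toℕ j) (ℕₚ.+-comm _ (toℕ j)) (ℕₚ.+-monoˡ-≤ (toℕ j) close)))) ,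
    (λ (i , j , i′ , j′ , a , a′ , i<i′ , i′<j′ , _ , eq) →
      unnested (proj₁ (same i j) a) (proj₁ (same i′ j′) a′) i<i′ i′<j′ (≡.trans eq (ℕₚ.+-comm (toℕ j′) 1)))

family-of-code : ∀ a k {c} → c ∈ codes a k →
  ∃[ π ] π ∈ filter (counted? k) (families (a ℕ.+ k)) × SameArcs π c
family-of-code a k {c} c∈ with ∈-extensions⁻ a k c∈
... | valid , refl , refl = π , ∈ₚ.∈-filter⁺ (counted? k) (filter∈sublists _ (subsets (a ℕ.+ k))) counted , same
  where open FamilyOf c (≡.sym (openers+closers c)) (valid⇒admissible c valid)

sameArcs-functional : ∀ {a k} {π : Family (a ℕ.+ k)} {c c′} → c ∈ codes a k → c′ ∈ codes a k →
  SameArcs π c → SameArcs π c′ → c ≡ c′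
sameArcs-functional {a} {k} {π} {c} {c′} c∈ c′∈ s s′ =
  linked-injective c c′ (≡.trans (len c∈) (≡.sym (len c′∈))) (transfer c∈ s s′) (transfer c′∈ s′ s)
  where
  len : ∀ {c} → c ∈ codes a k → length c ≡ a ℕ.+ k
  len {c} c∈ with ∈-extensions⁻ a k c∈
  ... | _ , refl , refl = ≡.sym (openers+closers c)

  transfer : ∀ {c c′} → c ∈ codes a k → SameArcs π c → SameArcs π c′ → ∀ {i j} → Linked c i j → Linked c′ i j
  transfer {c} c∈ s s′ l with linked-Fin c (len c∈) (valid⇒admissible c (proj₁ (∈-extensions⁻ a k c∈))) l
  ... | p , q , refl , refl = proj₁ (s′ p q) (proj₂ (s p q) l)

-- Equal arcs give equal sets of blocks through `Block`, and sublists of `subsets m` with the same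
-- members coincide.
sameArcs-injective : ∀ k {π π′ : Family m} {c} → π ∈ filter (counted? k) (families m) →
  π′ ∈ filter (counted? k) (families m) → SameArcs π c → SameArcs π′ c → π ≡ π′
sameArcs-injective {m = m} k π∈ π′∈ s s′
  with ∈ₚ.∈-filter⁻ (counted? k) {xs = families m} π∈ | ∈ₚ.∈-filter⁻ (counted? k) {xs = families m} π′∈
... | π∈f , matching , _ | π′∈f , matching′ , _ = sublists-ext (subsets-unique m) π∈f π′∈f
  (transfer matching matching′ s s′) (transfer matching′ matching s′ s)
  where
  transfer-block : ∀ {A A′ : Fin m → Fin m → Set} {B} →
    (∀ i j → A i j → A′ i j) → (∀ i j → A′ i j → A i j) → Block A B → Block A′ B
  transfer-block f g (single i p q) = single i (λ j → p j ∘ g i j) (λ j → q j ∘ g j i)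
  transfer-block f g (arc i<j a)    = arc i<j (f _ _ a)

  transfer : ∀ {π π′ : Family m} {c} → IsPartialMatching π → IsPartialMatching π′ → SameArcs π c → SameArcs π′ c →
    ∀ {B} → B ∈ π → B ∈ π′
  transfer matching matching′ s s′ B∈ = block⁻ matching′ (transfer-block
    (λ i j → proj₂ (s′ i j) ∘ proj₁ (s i j)) (λ i j → proj₂ (s i j) ∘ proj₁ (s′ i j)) (block⁺ matching B∈))

P≡closedCount : ∀ a k → P (a ℕ.+ k) k ≡ closedCount 0 0 a k
P≡closedCount a k = ≡.trans
  (ℕₚ.≤-antisym
    (unique-length-≤ SameArcs (Uniqueₚ.filter⁺ (counted? k) (sublists-unique (subsets-unique (a ℕ.+ k))))
      (code-of-counted a k) (sameArcs-injective k))
    (unique-length-≤ (λ c π → SameArcs π c) (extensions-unique a k [])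
      (family-of-code a k) (sameArcs-functional {a} {k})))
  (count-start a k)

theorem1p1 : ∃[ S ]
    (∑[n≥1] (λ n → ∑[ k < n ] (const (+ P (n +ℕ k ∸ 1) k) * x ^ n * y ^ k)) ⟶ S)
    ×
    (∑[n≥1] (λ n →
    x ^ n * (1# + x * y) ^ (n C 2)
    * (∏[ k < n ] (1# - (1# + x * y) ^ k * (x * y))) ⁻¹) ⟶ S)
theorem1p1 = S , lhs-converges P≡closedCount , rhs-converges
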